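{- For every $\gamma>2$ there is a polynomial-time $\bigl(\gamma,\frac{2\gamma}{\gamma-2}\bigr)$-approximation algorithm for the $k$-route multiway cut problem with unit edge costs. That is, given a finite undirected graph $G=(V,E)$ with $c_e=1$ for all $e\in E$, a set $T=\{t_1,\dots,t_r\}\subseteq V$ of terminals and an integer $k\ge 1$, the algorithm returns in polynomial time a set $F\subseteq E$ with $|F|\le\frac{2\gamma}{\gamma-2}\,\mathrm{OPT}$ such that $(V,E\setminus F)$ contains at most $\gamma(k-1)$ edge-disjoint paths between every pair of distinct terminals, where $\mathrm{OPT}$ is the optimal value of the $k$-route multiway cut instance.
   Context: $k$-route multiway cut problem: given a finite undirected graph $G=(V,E)$ with nonnegative edge costs $\{c_e\}_{e\in E}$, a set $T\subseteq V$ of $r$ terminals, and an integer $k\ge1$, find a minimum-cost set $F\subseteq E$ such that $(V,E\setminus F)$ contains at most $k-1$ edge-disjoint paths between every pair of distinct terminals. $\mathrm{OPT}$ denotes the minimum cost. An $(\alpha,\beta)$-approximation is a set $F\subseteq E$ with $\sum_{e\in F}c_e\le\beta\,\mathrm{OPT}$ such that $(V,E\setminus F)$ contains at most $\alpha(k-1)$ edge-disjoint paths between every pair of distinct terminals. -}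

module Defs where

open import Algebra.Bundles using (CommutativeRing)
import Algebra.Definitions.RawMonoid as RawMonoidDefinitions
import Algebra.Properties.Group as GroupProperties
open import Data.Bool using (Bool; true; false; if_then_else_; _∧_)
open import Data.Empty using (⊥)
open import Data.Fin using (Fin; toℕ; fromℕ<)
open import Data.Fin.Subset using (Subset; _∈_; _∉_; ∣_∣)
open import Data.List using (List; []; _∷_)
open import Data.List.Relation.Binary.Disjoint.Propositional using (Disjoint)
open import Data.List.Relation.Unary.All using (All)
open import Data.List.Relation.Unary.Unique.Propositional using (Unique)
open import Data.Nat using (ℕ; zero; suc; _+_; _*_; _∸_; _^_; _≤_; _<?_; _≡ᵇ_)
open import Data.Nat.Logarithm using (⌊log₂_⌋)
open import Data.Product using (Σ; _×_; _,_; ∃; ∃-syntax; proj₁; proj₂)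
open import Data.Sum using (_⊎_)
open import Data.Unit using (⊤)
open import Data.Vec using (lookup; tabulate)
open import Level using (Level; _⊔_; 0ℓ) renaming (suc to lsuc)
open import Relation.Binary using (Rel; IsDecTotalOrder)
import Relation.Binary.Construct.NonStrictToStrict as ToStrict
open import Relation.Binary.PropositionalEquality using (_≡_; _≢_)
open import Relation.Nullary using (¬_; does; yes; no)

-- The approximation factors are real numbers.  Nothing about ℝ beyond its
-- being an ordered field is needed to state the bounds, so they live in an
-- arbitrary (classical, i.e. decidably and totally) ordered field.

record OrderedField (c ℓ₁ ℓ₂ : Level) : Set (lsuc (c ⊔ ℓ₁ ⊔ ℓ₂)) where
  field
    commutativeRing : CommutativeRing c ℓ₁

  open CommutativeRing commutativeRing public
    using (Carrier; _≈_; 0#; 1#; -_)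
    renaming (_+_ to _+ᴷ_; _*_ to _*ᴷ_; _-_ to _-ᴷ_)

  infix 4 _≤ᴷ_

  field
    _≤ᴷ_            : Rel Carrier ℓ₂
    isDecTotalOrder : IsDecTotalOrder _≈_ _≤ᴷ_
    +-monoˡ-≤       : ∀ {x y} z → x ≤ᴷ y → (x +ᴷ z) ≤ᴷ (y +ᴷ z)
    *-nonneg        : ∀ {x y} → 0# ≤ᴷ x → 0# ≤ᴷ y → 0# ≤ᴷ (x *ᴷ y)
    0≉1             : ¬ (0# ≈ 1#)
    inverse         : ∀ x → ¬ (x ≈ 0#) → ∃[ y ] (x *ᴷ y) ≈ 1#

  open IsDecTotalOrder isDecTotalOrder public using () renaming (_≤?_ to _≤ᴷ?_)
  open ToStrict _≈_ _≤ᴷ_ public using () renaming (_<_ to _<ᴷ_)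

  open RawMonoidDefinitions (CommutativeRing.+-rawMonoid commutativeRing)
    using () renaming (_×_ to _times_)

  fromℕ : ℕ → Carrier
  fromℕ n = n times 1#

  divide : (x y : Carrier) → ¬ (y ≈ 0#) → Carrier
  divide x y y≉0 = x *ᴷ proj₁ (inverse y y≉0)

  <⇒-≉0 : ∀ {x y} → x <ᴷ y → ¬ ((y -ᴷ x) ≈ 0#)
  <⇒-≉0 {x} {y} (_ , x≉y) y-x≈0 = x≉y (CommutativeRing.sym commutativeRing
    (GroupProperties.x∙y⁻¹≈ε⇒x≈y (CommutativeRing.+-group commutativeRing) y x y-x≈0))

  2γ/[γ-2] : (γ : Carrier) → fromℕ 2 <ᴷ γ → Carrier
  2γ/[γ-2] γ 2<γ = divide (fromℕ 2 *ᴷ γ) (γ -ᴷ fromℕ 2) (<⇒-≉0 2<γ)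

-- Edges are named, so parallel edges (and loops) are allowed; simple graphs
-- are a special case.

record Graph : Set where
  field
    #V   : ℕ
    #E   : ℕ
    ends : Fin #E → Fin #V × Fin #V

module _ (G : Graph) where
  open Graph G

  Joins : Fin #E → Fin #V → Fin #V → Set
  Joins e u v = ends e ≡ (u , v) ⊎ ends e ≡ (v , u)

  data Walk : Fin #V → Fin #V → Set where
    stop : ∀ {v} → Walk v v
    step : ∀ {u v w} (e : Fin #E) → Joins e u v → Walk v w → Walk u w

  vertices : ∀ {u v} → Walk u v → List (Fin #V)
  vertices {u} stop         = u ∷ []
  vertices {u} (step _ _ w) = u ∷ vertices w

  edges : ∀ {u v} → Walk u v → List (Fin #E)
  edges stop         = []
  edges (step e _ w) = e ∷ edges w

  record PathAvoiding (F : Subset #E) (s t : Fin #V) : Set where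
    field
      walk   : Walk s t
      simple : Unique (vertices walk)
      avoids : All (_∉ F) (edges walk)

  pathEdges : ∀ {F s t} → PathAvoiding F s t → List (Fin #E)
  pathEdges p = edges (PathAvoiding.walk p)

  HasEdgeDisjointPaths : Subset #E → Fin #V → Fin #V → ℕ → Set
  HasEdgeDisjointPaths F s t j =
    Σ (Fin j → PathAvoiding F s t) λ P →
      ∀ a b → a ≢ b → Disjoint (pathEdges (P a)) (pathEdges (P b))

record Instance : Set where
  field
    graph : Graph
  open Graph graph public
  field
    terminals : Subset #V
    k         : ℕ
    k≥1       : 1 ≤ k

module _ (I : Instance) where
  open Instance I

  Feasible : Subset #E → Set
  Feasible F = ∀ s t → s ∈ terminals → t ∈ terminals → s ≢ t →
    ∀ j → HasEdgeDisjointPaths graph F s t j → j ≤ k ∸ 1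

  -- An optimum exists: deleting every edge is feasible.
  IsOPT : ℕ → Set
  IsOPT opt = (∃[ F ] Feasible F × ∣ F ∣ ≡ opt)
            × (∀ F → Feasible F → opt ≤ ∣ F ∣)

  record IsApproximation {c ℓ₁ ℓ₂} (K : OrderedField c ℓ₁ ℓ₂)
      (α β : OrderedField.Carrier K) (F : Subset #E) : Set ℓ₂ where
    open OrderedField K
    field
      cost         : ∀ opt → IsOPT opt → fromℕ ∣ F ∣ ≤ᴷ (β *ᴷ fromℕ opt)
      connectivity : ∀ s t → s ∈ terminals → t ∈ terminals → s ≢ t →
        ∀ j → HasEdgeDisjointPaths graph F s t j → fromℕ j ≤ᴷ (α *ᴷ fromℕ (k ∸ 1))

-- How the fixed constant γ is available to an algorithm.  A ratio of naturals
-- can be hard-wired into the program, so such a γ brings no extra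
-- instruction.  Any other constant is used as on a real RAM: the machine may
-- test a ≤ γ·b for naturals a, b.

data Presentation {c ℓ₁ ℓ₂} (K : OrderedField c ℓ₁ ℓ₂)
    (γ : OrderedField.Carrier K) : Set ℓ₁ where
  ratio : (p q : ℕ) → q ≢ 0 →
          (let open OrderedField K) → (fromℕ q *ᴷ γ) ≈ fromℕ p → Presentation K γ
  real  : Presentation K γ

Test : ∀ {c ℓ₁ ℓ₂} {K : OrderedField c ℓ₁ ℓ₂} {γ} → Presentation K γ → Set
Test (ratio _ _ _ _) = ⊥
Test real            = ⊤

runTest : ∀ {c ℓ₁ ℓ₂} {K : OrderedField c ℓ₁ ℓ₂} {γ} (pr : Presentation K γ) →
          Test pr → ℕ → ℕ → Bool
runTest {K = K} {γ} real _ a b = does (fromℕ a ≤ᴷ? (γ *ᴷ fromℕ b))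
  where open OrderedField K

-- Structured programs for a random access machine whose memory consists of
-- arrays of naturals, each indexed by a natural and addressed by a fixed
-- number; a scalar variable is an array used only at index 0.  Addition and truncated subtraction have unit cost and there is no
-- multiplication, so t steps create only numbers of O(t) more bits than the
-- input has, and running times agree with those of Turing machines up to a
-- polynomial.

module RAM (Q : Set) (test : Q → ℕ → ℕ → Bool) where

  State : Set
  State = ℕ → ℕ → ℕ

  infixl 6 _⊕_ _⊖_
  infix  8 _[_]
  infix  5 _[_]≔_
  infixr 4 _⨾_

  data Expr : Set where
    const   : ℕ → Expr
    _[_]    : ℕ → Expr → Expr
    _⊕_ _⊖_ : Expr → Expr → Expr
    ask     : Q → Expr → Expr → Expr

  data Program : Set where
    skip    : Program
    _[_]≔_  : ℕ → Expr → Expr → Program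
    _⨾_     : Program → Program → Program
    ifnz    : Expr → Program → Program → Program
    whilenz : Expr → Program → Program

  eval : Expr → State → ℕ
  eval (const n)   σ = n
  eval (x [ i ])   σ = σ x (eval i σ)
  eval (e ⊕ f)     σ = eval e σ + eval f σ
  eval (e ⊖ f)     σ = eval e σ ∸ eval f σ
  eval (ask q e f) σ = if test q (eval e σ) (eval f σ) then 1 else 0

  cost : Expr → ℕ
  cost (const _)   = 1
  cost (_ [ i ])   = suc (cost i)
  cost (e ⊕ f)     = suc (cost e + cost f)
  cost (e ⊖ f)     = suc (cost e + cost f)
  cost (ask _ e f) = suc (cost e + cost f)

  update : State → ℕ → ℕ → ℕ → State
  update σ x i v y j = if (x ≡ᵇ y) ∧ (i ≡ᵇ j) then v else σ y j

  -- ⟨ p , σ ⟩⇓ τ in-time t : started in σ, p halts in τ after t steps.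
  data ⟨_,_⟩⇓_in-time_ : Program → State → State → ℕ → Set where
    skip : ∀ {σ} → ⟨ skip , σ ⟩⇓ σ in-time 1
    assign : ∀ {σ x i e} →
      ⟨ x [ i ]≔ e , σ ⟩⇓ update σ x (eval i σ) (eval e σ) in-time suc (cost i + cost e)
    seq : ∀ {σ σ′ σ″ p q t u} →
      ⟨ p , σ ⟩⇓ σ′ in-time t → ⟨ q , σ′ ⟩⇓ σ″ in-time u →
      ⟨ p ⨾ q , σ ⟩⇓ σ″ in-time (t + u)
    if-nonzero : ∀ {σ σ′ e p q t} → eval e σ ≢ 0 →
      ⟨ p , σ ⟩⇓ σ′ in-time t →
      ⟨ ifnz e p q , σ ⟩⇓ σ′ in-time (suc (cost e) + t)
    if-zero : ∀ {σ σ′ e p q t} → eval e σ ≡ 0 →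
      ⟨ q , σ ⟩⇓ σ′ in-time t →
      ⟨ ifnz e p q , σ ⟩⇓ σ′ in-time (suc (cost e) + t)
    while-zero : ∀ {σ e p} → eval e σ ≡ 0 →
      ⟨ whilenz e p , σ ⟩⇓ σ in-time suc (cost e)
    while-nonzero : ∀ {σ σ′ σ″ e p t u} → eval e σ ≢ 0 →
      ⟨ p , σ ⟩⇓ σ′ in-time t → ⟨ whilenz e p , σ′ ⟩⇓ σ″ in-time u →
      ⟨ whilenz e p , σ ⟩⇓ σ″ in-time (suc (cost e) + (t + u))

toArray : ∀ {n} → (Fin n → ℕ) → ℕ → ℕ
toArray {n} f i with i <? n
... | yes i<n = f (fromℕ< i<n)
... | no  _   = 0

-- Arrays 0, 1, 2 hold #V, #E, k at index 0; arrays 3 and 4 the two ends of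
-- each edge; array 5 the indicator of the terminal set.  Everything else is 0.
input : Instance → ℕ → ℕ → ℕ
input I = λ where
    0 zero → #V
    1 zero → #E
    2 zero → k
    3 i    → toArray (λ e → toℕ (proj₁ (ends e))) i
    4 i    → toArray (λ e → toℕ (proj₂ (ends e))) i
    5 i    → toArray (λ v → if lookup terminals v then 1 else 0) i
    _ _    → 0
  where open Instance I

-- The answer is read off array 6: e ∈ F iff its entry at e is nonzero.
output : (I : Instance) → (ℕ → ℕ → ℕ) → Subset (Instance.#E I)
output I σ = tabulate λ e → nonzero (σ 6 (toℕ e))
  where
  nonzero : ℕ → Bool
  nonzero zero    = false
  nonzero (suc _) = true

-- k is written in binary.
size : Instance → ℕ
size I = #V + #E + suc ⌊log₂ k ⌋
  where open Instance I

HasPolynomialTimeApproximation :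
  ∀ {c ℓ₁ ℓ₂} (K : OrderedField c ℓ₁ ℓ₂) {γ : OrderedField.Carrier K} →
  Presentation K γ → (α β : OrderedField.Carrier K) → Set ℓ₂
HasPolynomialTimeApproximation K pr α β =
  ∃[ prog ] ∃[ C ] ∃[ d ] ∀ (I : Instance) →
    ∃[ σ ] ∃[ t ]
      ⟨ prog , input I ⟩⇓ σ in-time t
      × t ≤ C * size I ^ d
      × IsApproximation I K α β (output I σ)
  where open RAM (Test pr) (runTest pr)

{-# OPTIONS --safe #-}

-- Start with T′ = T.  While some t ∈ T′ has a minimum cut of at most γ(k - 1)
-- edges separating it from T′ ∖ {t}, drop t from T′ and start over; otherwise
-- delete such a minimum cut, of size d t, for every t ∈ T′.  Two terminals of
-- T′ end up disconnected, and any other pair was separated by a small cut when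
-- the first of the two was dropped.
--
-- For the cost, let F* be optimal.  By Menger's theorem any two terminals are
-- separated by a cut with at most k - 1 edges outside F*.  Refining the trivial
-- partition of V by at most |T′| of these cuts puts the terminals of T′ into
-- different classes, and at most OPT + |T′|(k - 1) edges join different classes.
-- The class of t isolates t, so it has at least d t boundary edges, whence
-- ∑ d t ≤ 2 OPT + 2 |T′|(k - 1).  Since d t ≥ γ(k - 1) for every t ∈ T′, the last
-- term is at most (2 / γ) ∑ d t.
module Submission where

open import Algebra.Bundles using (CommutativeRing)
import Algebra.Properties.CommutativeSemigroup as CommutativeSemigroupProperties
import Algebra.Properties.Ring as RingProperties
import Algebra.Properties.Semiring.Mult as Mult
import Algebra.Solver.Ring.NaturalCoefficients.Default as NaturalSolver
open import Data.Bool using (Bool; true; false; if_then_else_; _xor_; not; _∧_)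
import Data.Bool.Properties as Boolₚ
open import Data.Fin using (Fin; toℕ; fromℕ<)
import Data.Fin as Fin
open import Data.Fin.Properties using (toℕ<n; toℕ-injective; toℕ-fromℕ<; fromℕ<-toℕ; any?)
import Data.Fin.Properties as Finₚ
open import Data.Fin.Subset using (Subset; _∈_; _∉_; ∣_∣)
open import Data.List using (List; []; _∷_)
open import Data.List.Membership.Propositional using () renaming (_∈_ to _∈ₗ_; _∉_ to _∉ₗ_)
open import Data.List.Properties using (≡-dec; ∷-injectiveˡ; ∷-injectiveʳ)
open import Data.List.Relation.Unary.All using (All; []; _∷_)
import Data.List.Relation.Unary.All as All
open import Data.List.Relation.Unary.AllPairs using ([]; _∷_)
open import Data.List.Relation.Unary.Any using (here; there)
open import Data.List.Relation.Unary.Unique.Propositional using (Unique)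
open import Data.Nat hiding (_!)
open import Data.Nat.Properties
open import Data.Product
open import Data.Sum using (_⊎_; inj₁; inj₂)
open import Data.Unit using (⊤; tt)
open import Data.Vec using ([]; _∷_; lookup)
open import Data.Vec.Properties using (lookup∘tabulate; []=⇒lookup; lookup⇒[]=)
open import Function using (_∘_; case_of_)
open import Level using (Level)
open import Relation.Binary using (IsDecTotalOrder)
open import Relation.Binary.PropositionalEquality hiding ([_])
open import Relation.Nullary using (¬_; Dec; yes; no; contradiction; ¬?; _×-dec_; _⊎-dec_; does)
open import Defs

open CommutativeSemigroupProperties +-commutativeSemigroup using (interchange; xy∙z≈xz∙y)
open CommutativeSemigroupProperties *-commutativeSemigroup using () renaming (interchange to *-interchange)

-- Starting over after a drop is forced by the lower bound. With fewer terminals left more sets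
-- isolate each of them, so a cut computed earlier may no longer be minimal, whereas the classes of
-- the partition are compared with cuts that are all minimal for the same final T′. The small cuts
-- of dropped terminals are never deleted: they bound the disjoint paths already in G, so they
-- remain valid whatever happens later. A minimum cut is found by augmenting a flow one unit at a
-- time, and its value is at most the number of edges; the running time is therefore bounded in
-- terms of the graph alone, however large k is. The factor γ enters the program through a single
-- comparison of a cut value with γ(k - 1). The same calculus of residual capacities is used twice,
-- for the flow computed by the machine and for the proof of Menger's theorem. It works with the
-- capacity leaving a vertex set instead of conservation at vertices, which makes one equation per
-- set sufficient for duality, augmentation and decomposition into paths.

indicator : Bool → ℕ
indicator b = if b then 1 else 0

indicator≤1 : ∀ b → indicator b ≤ 1
indicator≤1 true  = ≤-refl
indicator≤1 false = z≤n

nonzero : ℕ → Bool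
nonzero zero    = false
nonzero (suc _) = true

nonzero-true : ∀ {x} → x ≢ 0 → nonzero x ≡ true
nonzero-true {zero}  x≢0 = contradiction refl x≢0
nonzero-true {suc _} _   = refl

nonzero⇒≢0 : ∀ {x} → nonzero x ≡ true → x ≢ 0
nonzero⇒≢0 {suc _} _ ()

nonzero-false : ∀ {x} → nonzero x ≡ false → x ≡ 0
nonzero-false {zero} _ = refl

true≢false : true ≢ false
true≢false ()

-- Point updates and finite sums

set : (ℕ → ℕ) → ℕ → ℕ → ℕ → ℕ
set f i v j = if i ≡ᵇ j then v else f j

set-same : ∀ f i v → set f i v i ≡ v
set-same f i v with i ≡ᵇ i | ≡⇒≡ᵇ i i refl
... | true | _ = refl

set-other : ∀ f {i j} v → i ≢ j → set f i v j ≡ f j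
set-other f {i} {j} v i≢j with i ≡ᵇ j | ≡ᵇ⇒≡ i j
... | true  | i≡j = contradiction (i≡j tt) i≢j
... | false | _   = refl

∑ : ℕ → (ℕ → ℕ) → ℕ
∑ zero    f = 0
∑ (suc n) f = ∑ n f + f n

∑-mono : ∀ n {f g} → (∀ i → i < n → f i ≤ g i) → ∑ n f ≤ ∑ n g
∑-mono zero    h = z≤n
∑-mono (suc n) h = +-mono-≤ (∑-mono n λ i i<n → h i (m<n⇒m<1+n i<n)) (h n ≤-refl)

∑-cong : ∀ n {f g} → (∀ i → i < n → f i ≡ g i) → ∑ n f ≡ ∑ n g
∑-cong zero    h = refl
∑-cong (suc n) h = cong₂ _+_ (∑-cong n λ i i<n → h i (m<n⇒m<1+n i<n)) (h n ≤-refl)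

∑-zero : ∀ n {f} → (∀ i → i < n → f i ≡ 0) → ∑ n f ≡ 0
∑-zero zero    h = refl
∑-zero (suc n) h = cong₂ _+_ (∑-zero n λ i i<n → h i (m<n⇒m<1+n i<n)) (h n ≤-refl)

∑-+ : ∀ n f g → ∑ n (λ i → f i + g i) ≡ ∑ n f + ∑ n g
∑-+ zero    f g = refl
∑-+ (suc n) f g = trans (cong (_+ (f n + g n)) (∑-+ n f g)) (interchange (∑ n f) (∑ n g) (f n) (g n))

∑-swap : ∀ n m (f : ℕ → ℕ → ℕ) → ∑ n (λ i → ∑ m (f i)) ≡ ∑ m (λ j → ∑ n (λ i → f i j))
∑-swap zero    m f = sym (∑-zero m λ _ _ → refl)
∑-swap (suc n) m f =
  trans (cong (_+ ∑ m (f n)) (∑-swap n m f)) (sym (∑-+ m (λ j → ∑ n (λ i → f i j)) (f n)))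

∑-≤-* : ∀ n {f c} → (∀ i → i < n → f i ≤ c) → ∑ n f ≤ n * c
∑-≤-* zero    h = z≤n
∑-≤-* (suc n) {f} {c} h =
  ≤-trans (+-mono-≤ (∑-≤-* n λ i i<n → h i (m<n⇒m<1+n i<n)) (h n ≤-refl)) (≤-reflexive (+-comm (n * c) c))

∑-shift : ∀ n f → ∑ (suc n) f ≡ f 0 + ∑ n (f ∘ suc)
∑-shift zero    f = sym (+-identityʳ (f 0))
∑-shift (suc n) f = trans (cong (_+ f (suc n)) (∑-shift n f)) (+-assoc (f 0) _ _)

-- Adding the exceptional terms crosswise expresses the change of a sum at one place without
-- subtraction, which would be truncated.
∑-exchange : ∀ n f g {j} → j < n → (∀ i → i < n → j ≢ i → f i ≡ g i) → ∑ n f + g j ≡ ∑ n g + f j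
∑-exchange (suc n) f g {j} j<1+n agree with j ≟ n
... | yes refl = begin
  ∑ j f + f j + g j    ≡⟨ cong (λ s → s + f j + g j) (∑-cong j λ i i<j → agree i (m<n⇒m<1+n i<j) (>⇒≢ i<j)) ⟩
  ∑ j g + f j + g j    ≡⟨ +-assoc (∑ j g) (f j) (g j) ⟩
  ∑ j g + (f j + g j)  ≡⟨ cong (∑ j g +_) (+-comm (f j) (g j)) ⟩
  ∑ j g + (g j + f j)  ≡⟨ sym (+-assoc (∑ j g) (g j) (f j)) ⟩
  ∑ j g + g j + f j    ∎
  where open ≡-Reasoning
... | no j≢n = begin
  ∑ n f + f n + g j    ≡⟨ xy∙z≈xz∙y (∑ n f) (f n) (g j) ⟩
  ∑ n f + g j + f n
    ≡⟨ cong₂ _+_ (∑-exchange n f g (≤∧≢⇒< (≤-pred j<1+n) j≢n) λ i i<n → agree i (m<n⇒m<1+n i<n)) (agree n ≤-refl j≢n) ⟩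
  ∑ n g + f j + g n    ≡⟨ xy∙z≈xz∙y (∑ n g) (f j) (g n) ⟩
  ∑ n g + g n + f j    ∎
  where open ≡-Reasoning

∑-indicator≤1 : ∀ n (p : ℕ → Bool) →
  (∀ i j → i < n → j < n → p i ≡ true → p j ≡ true → i ≡ j) → ∑ n (indicator ∘ p) ≤ 1
∑-indicator≤1 zero    p _ = z≤n
∑-indicator≤1 (suc n) p unique with p n in pn
... | false = ≤-trans (≤-reflexive (+-identityʳ _))
                (∑-indicator≤1 n p λ i j i<n j<n → unique i j (m<n⇒m<1+n i<n) (m<n⇒m<1+n j<n))
... | true  = ≤-reflexive (cong (_+ 1) (∑-zero n others))
  where
  others : ∀ i → i < n → indicator (p i) ≡ 0
  others i i<n with p i in pi
  ... | false = refl
  ... | true  = contradiction (unique i n (m<n⇒m<1+n i<n) ≤-refl pi pn) (<⇒≢ i<n)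

-- Clearing the weight at the first value of `h` lowers the sum by at least 1, and injectivity keeps
-- the weights at the other values nonzero, so induction on `j` applies.
injection⇒≤∑ : ∀ j m (h : Fin j → ℕ) (w : ℕ → ℕ) → (∀ a → h a < m) → (∀ a → w (h a) ≢ 0) →
  (∀ a b → h a ≡ h b → a ≡ b) → j ≤ ∑ m w
injection⇒≤∑ zero    m h w h<m w≢0 inj = z≤n
injection⇒≤∑ (suc j) m h w h<m w≢0 inj = begin
  suc j
    ≤⟨ s≤s (injection⇒≤∑ j m (h ∘ Fin.suc) w′ (h<m ∘ Fin.suc) w′≢0 λ a b eq → Finₚ.suc-injective (inj _ _ eq)) ⟩
  suc (∑ m w′)          ≡⟨ sym (+-comm (∑ m w′) 1) ⟩
  ∑ m w′ + 1            ≤⟨ +-monoʳ-≤ (∑ m w′) (n≢0⇒n>0 (w≢0 Fin.zero)) ⟩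
  ∑ m w′ + w h₀         ≡⟨ ∑-exchange m w′ w (h<m Fin.zero) (λ i _ → set-other w 0) ⟩
  ∑ m w + w′ h₀         ≡⟨ cong (∑ m w +_) (set-same w h₀ 0) ⟩
  ∑ m w + 0             ≡⟨ +-identityʳ _ ⟩
  ∑ m w                 ∎
  where
  open ≤-Reasoning
  h₀ = h Fin.zero
  w′ = set w h₀ 0
  w′≢0 : ∀ a → w′ (h (Fin.suc a)) ≢ 0
  w′≢0 a eq = w≢0 (Fin.suc a) (trans (sym (set-other w 0 λ h₀≡ → case inj _ _ h₀≡ of λ ())) eq)

-- The pair is written as a two-digit number in base `suc Y`; nested, this turns lexicographic
-- termination measures into the numerical ones that also bound the time.
lex-< : ∀ {x x′ y y′} Y → x′ < x → y′ ≤ Y → x′ * suc Y + y′ < x * suc Y + y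
lex-< {x} {x′} {y} {y′} Y x′<x y′≤Y = begin-strict
  x′ * suc Y + y′       <⟨ +-monoʳ-< (x′ * suc Y) (s≤s y′≤Y) ⟩
  x′ * suc Y + suc Y    ≡⟨ +-comm (x′ * suc Y) (suc Y) ⟩
  suc x′ * suc Y        ≤⟨ *-monoˡ-≤ (suc Y) x′<x ⟩
  x * suc Y             ≤⟨ m≤m+n _ y ⟩
  x * suc Y + y         ∎
  where open ≤-Reasoning

-- Polynomial bounds in two parameters

Polynomial : (ℕ → ℕ → ℕ) → Set
Polynomial f = ∃[ C ] ∃[ d ] ∀ n m N → 1 ≤ N → n ≤ N → m ≤ N → f n m ≤ C * N ^ d

poly-const : ∀ c → Polynomial (λ _ _ → c)
poly-const c = c , 0 , λ _ _ _ _ _ _ → ≤-reflexive (sym (*-identityʳ c))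

poly-fst : Polynomial (λ n _ → n)
poly-fst = 1 , 1 , λ n m N _ n≤N _ → ≤-trans n≤N (≤-reflexive (sym (trans (*-identityˡ _) (*-identityʳ N))))

poly-snd : Polynomial (λ _ m → m)
poly-snd = 1 , 1 , λ n m N _ _ m≤N → ≤-trans m≤N (≤-reflexive (sym (trans (*-identityˡ _) (*-identityʳ N))))

-- Since `1 ≤ N`, powers of `N` are monotone in the exponent, so both terms can be raised to the
-- common exponent `d + e`.
poly-+ : ∀ {f g} → Polynomial f → Polynomial g → Polynomial (λ n m → f n m + g n m)
poly-+ (C , d , f≤) (D , e , g≤) = C + D , d + e , bound
  where
  bound : ∀ n m N → _ → _ → _ → _
  bound n m N 1≤N n≤N m≤N =
    ≤-trans
      (+-mono-≤ (≤-trans (f≤ n m N 1≤N n≤N m≤N) (*-monoʳ-≤ C (^-monoʳ-≤ N {{>-nonZero 1≤N}} (m≤m+n d e))))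
                (≤-trans (g≤ n m N 1≤N n≤N m≤N) (*-monoʳ-≤ D (^-monoʳ-≤ N {{>-nonZero 1≤N}} (m≤n+m e d)))))
      (≤-reflexive (sym (*-distribʳ-+ (N ^ (d + e)) C D)))

poly-* : ∀ {f g} → Polynomial f → Polynomial g → Polynomial (λ n m → f n m * g n m)
poly-* (C , d , f≤) (D , e , g≤) = C * D , d + e , λ n m N 1≤N n≤N m≤N →
  ≤-trans (*-mono-≤ (f≤ n m N 1≤N n≤N m≤N) (g≤ n m N 1≤N n≤N m≤N))
    (≤-reflexive (trans (*-interchange C (N ^ d) D (N ^ e))
                        (cong (C * D *_) (sym (^-distribˡ-+-* N d e)))))

-- Program logic

module HoareLogic (Q : Set) (test : Q → ℕ → ℕ → Bool) where
  open RAM Q test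

  private variable
    ℓ ℓ′ : Level

  -- A Hoare triple at a single initial state, with termination and a time bound included: what is
  -- known about `σ` enters as ordinary hypotheses instead of a precondition.
  Run : Program → State → ℕ → (State → Set ℓ) → Set ℓ
  Run p σ B Post = ∃[ σ′ ] ∃[ t ] ⟨ p , σ ⟩⇓ σ′ in-time t × t ≤ B × Post σ′

  run-mono : ∀ {p σ B} {Post : State → Set ℓ} {Post′ : State → Set ℓ′} →
    Run p σ B Post → (∀ {σ′} → Post σ′ → Post′ σ′) → Run p σ B Post′
  run-mono (σ′ , t , r , t≤B , post) f = σ′ , t , r , t≤B , f post

  run-assign : ∀ {σ x i e} {Post : State → Set ℓ} → Post (update σ x (eval i σ) (eval e σ)) →
    Run (x [ i ]≔ e) σ (suc (cost i + cost e)) Post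
  run-assign post = _ , _ , assign , ≤-refl , post

  run-seq : ∀ {p q σ B B′} {Mid : State → Set ℓ} {Post : State → Set ℓ′} → Run p σ B Mid →
    (∀ {σ′} → Mid σ′ → Run q σ′ B′ Post) → Run (p ⨾ q) σ (B + B′) Post
  run-seq (σ₁ , t , r , t≤B , mid) f with f mid
  ... | σ₂ , u , s , u≤B′ , post = σ₂ , t + u , seq r s , +-mono-≤ t≤B u≤B′ , post

  run-assign-seq : ∀ {q σ x i e B} {Post : State → Set ℓ} →
    Run q (update σ x (eval i σ) (eval e σ)) B Post →
    Run (x [ i ]≔ e ⨾ q) σ (suc (cost i + cost e) + B) Post
  run-assign-seq (σ₂ , u , s , u≤B , post) = σ₂ , _ , seq assign s , +-monoʳ-≤ _ u≤B , post

  -- The bounds of the two branches are added, not maximised, so that all running times are built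
  -- from sums and products only.
  run-if : ∀ {e p q σ B B′} {Post : State → Set ℓ} →
    (eval e σ ≢ 0 → Run p σ B Post) → (eval e σ ≡ 0 → Run q σ B′ Post) →
    Run (ifnz e p q) σ (suc (cost e) + (B + B′)) Post
  run-if {e = e} {σ = σ} {B = B} {B′ = B′} f g with eval e σ ≟ 0
  ... | no ≢0 with f ≢0
  ...   | σ′ , t , r , t≤B , post =
    σ′ , _ , if-nonzero ≢0 r , +-monoʳ-≤ (suc (cost e)) (m≤n⇒m≤n+o B′ t≤B) , post
  run-if {e = e} {σ = σ} {B = B} {B′ = B′} f g | yes ≡0 with g ≡0
  ...   | σ′ , t , r , t≤B′ , post =
    σ′ , _ , if-zero ≡0 r , +-monoʳ-≤ (suc (cost e)) (m≤n⇒m≤o+n B t≤B′) , post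

  -- The measure `μ` is read off the state, whereas `M` is a bound known in advance. At most `M`
  -- rounds are possible, and one more evaluation of the condition ends the loop.
  run-while : ∀ {e p B} (I : ℕ → State → Set ℓ) →
    (∀ μ σ → I μ σ → eval e σ ≢ 0 → Run p σ B (λ σ′ → ∃[ μ′ ] μ′ < μ × I μ′ σ′)) →
    ∀ {M μ σ} → μ ≤ M → I μ σ →
    Run (whilenz e p) σ (suc M * (suc (cost e) + B)) (λ σ′ → ∃[ μ′ ] I μ′ σ′ × eval e σ′ ≡ 0)
  run-while {e = e} {p} {B} I body {M} {μ} {σ} μ≤M inv with eval e σ ≟ 0
  ... | yes ≡0 = σ , _ , while-zero ≡0 , ≤-trans (m≤m+n _ B) (m≤m+n _ _) , μ , inv , ≡0
  ... | no  ≢0 with body μ σ inv ≢0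
  ...   | σ₁ , t , r , t≤B , μ′ , μ′<μ , inv′ with M
  ...     | zero   = contradiction (≤-trans μ′<μ μ≤M) λ ()
  ...     | suc M′ with run-while I body (≤-pred (≤-trans μ′<μ μ≤M)) inv′
  ...       | σ₂ , u , s , u≤ , post =
    σ₂ , _ , while-nonzero ≢0 r s ,
    ≤-trans (≤-reflexive (sym (+-assoc (suc (cost e)) t u)))
            (+-mono-≤ (+-monoʳ-≤ (suc (cost e)) t≤B) u≤) , post

-- Unit flows with residual capacities

module Network (n m : ℕ) (A B : ℕ → ℕ) where

  src dst : Bool → ℕ → ℕ
  src true  = A
  src false = B
  dst true  = B
  dst false = A

  crosses : (ℕ → Bool) → ℕ → Bool
  crosses X e = X (A e) xor X (B e)

  δ : (ℕ → Bool) → ℕ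
  δ X = ∑ m (indicator ∘ crosses X)

  capAt : Bool → ℕ → ℕ
  capAt true  x = 2 ∸ x
  capAt false x = x

  cap : (ℕ → ℕ) → Bool → ℕ → ℕ
  cap g d e = capAt d (g e)

  bump : Bool → ℕ → ℕ
  bump true  x = suc x
  bump false x = x ∸ 1

  push : (ℕ → ℕ) → Bool → ℕ → ℕ → ℕ
  push g d e = set g e (bump d (g e))

  -- The arguments are the sides of the tail and of the head and the flow code of the edge; the
  -- value is its residual capacity in the outward direction. Thus `ρ` is the residual capacity
  -- leaving a set.
  leaveAt : Bool → Bool → ℕ → ℕ
  leaveAt true  true  _ = 0
  leaveAt true  false x = 2 ∸ x
  leaveAt false true  x = x
  leaveAt false false _ = 0

  leave : (ℕ → ℕ) → (ℕ → Bool) → ℕ → ℕ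
  leave g X e = leaveAt (X (A e)) (X (B e)) (g e)

  ρ : (ℕ → ℕ) → (ℕ → Bool) → ℕ
  ρ g X = ∑ m (leave g X)

  δ≤m : ∀ X → δ X ≤ m
  δ≤m X = ≤-trans (∑-≤-* m λ e _ → indicator≤1 (crosses X e)) (≤-reflexive (*-identityʳ m))

  -- A push takes one unit of capacity from its own direction and gives it to the reverse one. The
  -- capacity leaving the set falls by 1 if the arc leaves the set, rises by 1 if the arc enters it,
  -- and is unchanged otherwise.
  leaveAt-bump : ∀ d x y v → v ≤ 2 → capAt d v ≢ 0 →
    leaveAt x y (bump d v) + indicator (if d then x else y) ≡ leaveAt x y v + indicator (if d then y else x)
  leaveAt-bump true  true  true  _ _ _ = refl
  leaveAt-bump true  false false _ _ _ = refl
  leaveAt-bump true  true  false 0 _ _ = refl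
  leaveAt-bump true  true  false 1 _ _ = refl
  leaveAt-bump true  true  false 2 _ c = contradiction refl c
  leaveAt-bump true  true  false (suc (suc (suc _))) (s≤s (s≤s ())) _
  leaveAt-bump true  false true  v _ _ = trans (+-identityʳ (suc v)) (+-comm 1 v)
  leaveAt-bump false true  true  _ _ _ = refl
  leaveAt-bump false false false _ _ _ = refl
  leaveAt-bump false true  false 0 _ c = contradiction refl c
  leaveAt-bump false true  false 1 _ _ = refl
  leaveAt-bump false true  false 2 _ _ = refl
  leaveAt-bump false true  false (suc (suc (suc _))) (s≤s (s≤s ())) _
  leaveAt-bump false false true  0 _ c = contradiction refl c
  leaveAt-bump false false true  (suc v) _ _ = trans (+-comm v 1) (sym (+-identityʳ (suc v)))

  bump≤2 : ∀ d v → v ≤ 2 → capAt d v ≢ 0 → bump d v ≤ 2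
  bump≤2 true  0 _ _ = s≤s z≤n
  bump≤2 true  1 _ _ = s≤s (s≤s z≤n)
  bump≤2 true  2 _ c = contradiction refl c
  bump≤2 true  (suc (suc (suc _))) (s≤s (s≤s ())) _
  bump≤2 false v v≤2 _ = ≤-trans (m∸n≤m v 1) v≤2

  Bounded : (ℕ → ℕ) → Set
  Bounded g = ∀ e → e < m → g e ≤ 2

  push-bounded : ∀ {g d e} → Bounded g → e < m → cap g d e ≢ 0 → Bounded (push g d e)
  push-bounded {g} {d} {e} bdd e<m c i i<m with e ≟ i
  ... | yes refl rewrite set-same g e (bump d (g e)) = bump≤2 d (g e) (bdd e e<m) c
  ... | no  e≢i  rewrite set-other g (bump d (g e)) e≢i = bdd i i<m

  -- With the source on one side and the target on the other, these equations telescope along a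
  -- walk.
  push-ρ : ∀ {g d e} X → Bounded g → e < m → cap g d e ≢ 0 →
    ρ (push g d e) X + indicator (X (src d e)) ≡ ρ g X + indicator (X (dst d e))
  push-ρ {g} {d} {e} X bdd e<m c = +-cancelʳ-≡ (leave g X e) _ _ (begin
    ρ g′ X + s + leave g X e     ≡⟨ xy∙z≈xz∙y (ρ g′ X) s (leave g X e) ⟩
    ρ g′ X + leave g X e + s     ≡⟨ cong (_+ s) (∑-exchange m (leave g′ X) (leave g X) e<m
                                      λ i _ e≢i → cong (leaveAt (X (A i)) (X (B i))) (set-other g _ e≢i)) ⟩
    ρ g X + leave g′ X e + s     ≡⟨ +-assoc (ρ g X) _ s ⟩
    ρ g X + (leave g′ X e + s)   ≡⟨ cong (ρ g X +_) (local d c) ⟩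
    ρ g X + (leave g X e + t)    ≡⟨ cong (ρ g X +_) (+-comm _ t) ⟩
    ρ g X + (t + leave g X e)    ≡⟨ sym (+-assoc (ρ g X) t _) ⟩
    ρ g X + t + leave g X e      ∎)
    where
    open ≡-Reasoning
    g′ = push g d e
    s = indicator (X (src d e))
    t = indicator (X (dst d e))
    local : ∀ d → cap g d e ≢ 0 →
      leave (push g d e) X e + indicator (X (src d e)) ≡ leave g X e + indicator (X (dst d e))
    local true  c rewrite set-same g e (suc (g e)) = leaveAt-bump true  (X (A e)) (X (B e)) (g e) (bdd e e<m) c
    local false c rewrite set-same g e (g e ∸ 1)   = leaveAt-bump false (X (A e)) (X (B e)) (g e) (bdd e e<m) c

  -- g e ∈ {0 , 1 , 2} encodes a unit of flow from B e to A e, no flow, or a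
  -- unit from A e to B e, so cap is the residual capacity.  Conservation
  -- is only ever used through the net flow out of the sets X that separate
  -- the source from the sinks, and that is δ X ∸ ρ g X.
  record Flow (Separates : (ℕ → Bool) → Set) (g : ℕ → ℕ) (val : ℕ) : Set where
    field
      bounded : Bounded g
      balance : ∀ X → Separates X → ρ g X + val ≡ δ X

    value≤δ : ∀ {X} → Separates X → val ≤ δ X
    value≤δ sep = ≤-trans (m≤n+m val _) (≤-reflexive (balance _ sep))

  open Flow

  zero-flow : ∀ {S g} → (∀ e → e < m → g e ≡ 1) → Flow S g 0
  zero-flow {g = g} g≡1 = record
    { bounded = λ e e<m → ≤-trans (≤-reflexive (g≡1 e e<m)) (s≤s z≤n)
    ; balance = λ X _ → trans (+-identityʳ _) (∑-cong m λ e e<m →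
        trans (cong (leaveAt (X (A e)) (X (B e))) (g≡1 e e<m)) (neutral (X (A e)) (X (B e))))
    }
    where
    neutral : ∀ x y → leaveAt x y 1 ≡ indicator (x xor y)
    neutral true  true  = refl
    neutral true  false = refl
    neutral false true  = refl
    neutral false false = refl

  saturated⇒ρ≡0 : ∀ {g} X →
    (∀ e → e < m → ∀ d → X (src d e) ≡ true → X (dst d e) ≡ false → cap g d e ≡ 0) → ρ g X ≡ 0
  saturated⇒ρ≡0 {g} X sat = ∑-zero m λ e e<m → local e (sat e e<m true) (sat e e<m false)
    where
    local : ∀ e → (X (A e) ≡ true → X (B e) ≡ false → 2 ∸ g e ≡ 0) →
      (X (B e) ≡ true → X (A e) ≡ false → g e ≡ 0) → leave g X e ≡ 0
    local e f b with X (A e) | X (B e)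
    ... | true  | true  = refl
    ... | true  | false = f refl refl
    ... | false | true  = b refl refl
    ... | false | false = refl

  record MinCut (Separates : (ℕ → Bool) → Set) (val : ℕ) (R : ℕ → Bool) : Set where
    field
      separates : Separates R
      δ≡value      : δ R ≡ val
      minimal   : ∀ X → Separates X → val ≤ δ X

  -- Max-flow min-cut duality: as no capacity leaves `R`, the balance at `R` becomes `δ R ≡ val`,
  -- while the balance at any other separating set gives `val ≤ δ X`.
  saturated⇒MinCut : ∀ {S g val} R → Flow S g val → S R →
    (∀ e → e < m → ∀ d → R (src d e) ≡ true → R (dst d e) ≡ false → cap g d e ≡ 0) → MinCut S val R
  saturated⇒MinCut R fl sep sat = record
    { separates = sep
    ; δ≡value      = trans (sym (balance fl R sep)) (cong (_+ _) (saturated⇒ρ≡0 R sat))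
    ; minimal   = λ X → value≤δ fl
    }

  unmarked : (ℕ → ℕ) → ℕ
  unmarked mark = ∑ n (indicator ∘ not ∘ nonzero ∘ mark)

  unmarked-set : ∀ mark {b x} → b < n → mark b ≡ 0 → x ≢ 0 → suc (unmarked (set mark b x)) ≡ unmarked mark
  unmarked-set mark {b} {x} b<n b≡0 x≢0 = begin
    suc (unmarked (set mark b x))                         ≡⟨ +-comm 1 _ ⟩
    unmarked (set mark b x) + 1
      ≡⟨ cong (λ y → unmarked (set mark b x) + indicator (not (nonzero y))) (sym b≡0) ⟩
    unmarked (set mark b x) + indicator (not (nonzero (mark b)))
      ≡⟨ ∑-exchange n _ _ b<n (λ v _ b≢v → cong (indicator ∘ not ∘ nonzero) (set-other mark x b≢v)) ⟩
    unmarked mark + indicator (not (nonzero (set mark b x b)))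
      ≡⟨ cong (λ y → unmarked mark + indicator (not (nonzero y))) (set-same mark b x) ⟩
    unmarked mark + indicator (not (nonzero x))
      ≡⟨ cong (λ y → unmarked mark + indicator (not y)) (nonzero-true x≢0) ⟩
    unmarked mark + 0                                     ≡⟨ +-identityʳ _ ⟩
    unmarked mark                                         ∎
    where open ≡-Reasoning

  unmarked≤n : ∀ mark → unmarked mark ≤ n
  unmarked≤n mark = ≤-trans (∑-≤-* n λ v _ → indicator≤1 (not (nonzero (mark v)))) (≤-reflexive (*-identityʳ n))

-- Augmenting along a search tree

dirCode : Bool → ℕ
dirCode true  = 1
dirCode false = 0

nonzero-dirCode : ∀ d → nonzero (dirCode d) ≡ d
nonzero-dirCode true  = refl
nonzero-dirCode false = refl

record Isolates (n : ℕ) (live : ℕ → ℕ) (t : ℕ) (X : ℕ → Bool) : Set where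
  field
    inside  : X t ≡ true
    outside : ∀ v → v < n → live v ≢ 0 → v ≢ t → X v ≡ false

module Augmentation (n m : ℕ) (A B : ℕ → ℕ)
  (A<n : ∀ e → e < m → A e < n) (B<n : ∀ e → e < m → B e < n)
  (live : ℕ → ℕ) (t : ℕ) (t<n : t < n) where

  open Network n m A B

  src<n : ∀ d e → e < m → src d e < n
  src<n true  = A<n
  src<n false = B<n

  dst<n : ∀ d e → e < m → dst d e < n
  dst<n true  = B<n
  dst<n false = A<n

  Separating : (ℕ → Bool) → Set
  Separating = Isolates n live t

  -- The field `rank` serves twice: the walk back to the root terminates because marks decrease, and
  -- its edges are distinct, so a push along one arc leaves the next arcs residual.
  record TreeArc (g mark : ℕ → ℕ) (v e : ℕ) (d : Bool) : Set where
    field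
      edge<m   : e < m
      head     : dst d e ≡ v
      rank     : mark v ≡ suc (mark (src d e))
      residual : cap g d e ≢ 0
      reached  : mark (src d e) ≢ 0

  -- mark is 0 off the search tree and one more than the depth on it.
  record Tree (g mark par dir : ℕ → ℕ) : Set where
    field
      root   : mark t ≡ 1
      unique : ∀ v → v < n → mark v ≡ 1 → v ≡ t
      arc    : ∀ v → v < n → 2 ≤ mark v → TreeArc g mark v (par v) (nonzero (dir v))

  tree-extend : ∀ {g mark par dir} d e → Tree g mark par dir → e < m →
    mark (src d e) ≢ 0 → mark (dst d e) ≡ 0 → cap g d e ≢ 0 →
    Tree g (set mark (dst d e) (suc (mark (src d e)))) (set par (dst d e) e) (set dir (dst d e) (dirCode d))
  tree-extend {g} {mark} {par} {dir} d e tree e<m a≢0 b≡0 c = record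
    { root = trans (other (λ b≡t → 0≢1+n (trans (sym b≡0) (trans (cong mark b≡t) root)))) root
    ; unique = unique′
    ; arc = arc′
    }
    where
    open Tree tree
    a = src d e
    b = dst d e
    mark′ = set mark b (suc (mark a))
    other : ∀ {v} → b ≢ v → mark′ v ≡ mark v
    other = set-other mark (suc (mark a))
    same : mark′ b ≡ suc (mark a)
    same = set-same mark b (suc (mark a))
    b≢ : ∀ {v} → mark v ≢ 0 → b ≢ v
    b≢ v≢0 refl = v≢0 b≡0
    unique′ : ∀ v → v < n → mark′ v ≡ 1 → v ≡ t
    unique′ v v<n eq with b ≟ v
    ... | yes refl = contradiction (suc-injective (trans (sym same) eq)) a≢0
    ... | no  b≢v  = unique v v<n (trans (sym (other b≢v)) eq)
    arc′ : ∀ v → v < n → 2 ≤ mark′ v →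
      TreeArc g mark′ v (set par b e v) (nonzero (set dir b (dirCode d) v))
    arc′ v v<n 2≤ with b ≟ v
    ... | yes refl rewrite set-same par b e | set-same dir b (dirCode d) | nonzero-dirCode d = record
      { edge<m = e<m
      ; head = refl
      ; rank = trans same (cong suc (sym (other (b≢ a≢0))))
      ; residual = c
      ; reached = λ eq → a≢0 (trans (sym (other (b≢ a≢0))) eq)
      }
    ... | no b≢v rewrite set-other par e b≢v | set-other dir (dirCode d) b≢v = record
      { edge<m = edge<m
      ; head = head
      ; rank = trans (other b≢v) (trans rank (cong suc (sym (other (b≢ reached)))))
      ; residual = residual
      ; reached = λ eq → reached (trans (sym (other (b≢ reached))) eq)
      }
      where open TreeArc (arc v v<n (subst (2 ≤_) (other b≢v) 2≤))

  -- A unit of flow has been pushed along the tree path from cur to a sink.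
  record Trace (val : ℕ) (mark par dir g : ℕ → ℕ) (cur : ℕ) : Set where
    field
      cur<n   : cur < n
      reached : mark cur ≢ 0
      bounded : Bounded g
      balance : ∀ X → Separating X → ρ g X + (val + indicator (X cur)) ≡ δ X
      intact  : ∀ v → v < n → 2 ≤ mark v → mark v ≤ mark cur →
                TreeArc g mark v (par v) (nonzero (dir v))

  trace-start : ∀ {g val mark par dir b} → Flow Separating g val → Tree g mark par dir →
    b < n → live b ≢ 0 → b ≢ t → mark b ≢ 0 → Trace val mark par dir g b
  trace-start {val = val} fl tree b<n live-b b≢t b≢0 = record
    { cur<n   = b<n
    ; reached = b≢0
    ; bounded = Flow.bounded fl
    ; balance = λ X iso → trans
        (cong (_ +_) (trans (cong (λ x → val + indicator x) (Isolates.outside iso _ b<n live-b b≢t)) (+-identityʳ val)))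
        (Flow.balance fl X iso)
    ; intact  = λ v v<n 2≤ _ → Tree.arc tree v v<n 2≤
    }

  -- The arcs enter vertices of different marks, so they are not the same arc. If they were the two
  -- directions of one edge, the arc into `v` would start at `c`, and `v` would be marked higher
  -- than `c`. Hence a push into `c` does not affect tree arcs into vertices of smaller mark.
  edges-differ : ∀ {mark : ℕ → ℕ} d e d′ e′ {v c} → dst d e ≡ v → dst d′ e′ ≡ c →
    mark v ≡ suc (mark (src d e)) → mark v < mark c → e′ ≢ e
  edges-differ true  e true  .e refl refl _    v<c refl = <-irrefl refl v<c
  edges-differ false e false .e refl refl _    v<c refl = <-irrefl refl v<c
  edges-differ true  e false .e refl refl rank v<c refl = <-asym v<c (≤-reflexive (sym rank))
  edges-differ false e true  .e refl refl rank v<c refl = <-asym v<c (≤-reflexive (sym rank))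

  trace-step : ∀ {val mark par dir g cur} → Trace val mark par dir g cur → 2 ≤ mark cur →
    let e = par cur ; d = nonzero (dir cur) in
    mark cur ≡ suc (mark (src d e)) × Trace val mark par dir (push g d e) (src d e)
  trace-step {val} {mark} {par} {dir} {g} {cur} tr 2≤cur = C.rank , record
    { cur<n   = src<n d e C.edge<m
    ; reached = C.reached
    ; bounded = push-bounded {g} {d} bounded C.edge<m C.residual
    ; balance = balance′
    ; intact  = intact′
    }
    where
    open Trace tr
    e = par cur
    d = nonzero (dir cur)
    module C = TreeArc (intact cur cur<n 2≤cur ≤-refl)
    open ≡-Reasoning
    balance′ : ∀ X → Separating X → ρ (push g d e) X + (val + indicator (X (src d e))) ≡ δ X
    balance′ X iso = begin
      ρ (push g d e) X + (val + s)    ≡⟨ cong (ρ (push g d e) X +_) (+-comm val s) ⟩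
      ρ (push g d e) X + (s + val)    ≡⟨ sym (+-assoc _ s val) ⟩
      ρ (push g d e) X + s + val      ≡⟨ cong (_+ val) (push-ρ {g} {d} X bounded C.edge<m C.residual) ⟩
      ρ g X + indicator (X (dst d e)) + val ≡⟨ cong (λ v → ρ g X + indicator (X v) + val) C.head ⟩
      ρ g X + indicator (X cur) + val ≡⟨ +-assoc (ρ g X) _ val ⟩
      ρ g X + (indicator (X cur) + val) ≡⟨ cong (ρ g X +_) (+-comm _ val) ⟩
      ρ g X + (val + indicator (X cur)) ≡⟨ balance X iso ⟩
      δ X ∎
      where s = indicator (X (src d e))
    intact′ : ∀ v → v < n → 2 ≤ mark v → mark v ≤ mark (src d e) →
      TreeArc (push g d e) mark v (par v) (nonzero (dir v))
    intact′ v v<n 2≤v v≤ = record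
      { edge<m = V.edge<m ; head = V.head ; rank = V.rank ; reached = V.reached
      ; residual = λ eq → V.residual (trans (cong (capAt (nonzero (dir v))) (sym (set-other g _ e≢))) eq)
      }
      where
      v<cur : mark v < mark cur
      v<cur = ≤-trans (s≤s v≤) (≤-reflexive (sym C.rank))
      module V = TreeArc (intact v v<n 2≤v (<⇒≤ v<cur))
      e≢ : e ≢ par v
      e≢ = edges-differ {mark} (nonzero (dir v)) (par v) d e V.head C.head V.rank v<cur

  -- The root lies in every separating set, so the indicator in the balance, which was 0 at the
  -- sink, is now 1 and becomes the new unit of value.
  trace-end : ∀ {val mark par dir g} → Trace val mark par dir g t → Flow Separating g (suc val)
  trace-end {val} {g = g} tr = record
    { bounded = Trace.bounded tr
    ; balance = λ X iso → trans (cong (ρ g X +_) (trans (+-comm 1 val) (cong (λ x → val + indicator x) (sym (Isolates.inside iso)))))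
                                (Trace.balance tr X iso)
    }

  -- The edges below `e` are known to lead to no new vertex; a new mark may reopen them, so it sends
  -- `e` back to 0. The field `depth` bounds the marks, hence the length of a trace: a new mark is
  -- one more than an old one, but uses up an unmarked vertex.
  record Scan (g : ℕ → ℕ) (val : ℕ) (mark par dir : ℕ → ℕ) (e : ℕ) : Set where
    field
      flow    : Flow Separating g val
      tree    : Tree g mark par dir
      e≤m     : e ≤ m
      no-sink : ∀ v → v < n → mark v ≢ 0 → live v ≢ 0 → v ≡ t
      closed  : ∀ i → i < e → ∀ d → mark (src d i) ≢ 0 → cap g d i ≢ 0 → mark (dst d i) ≢ 0
      depth   : ∀ v → v < n → mark v + unmarked mark ≤ n

  Fresh : (ℕ → ℕ) → Set
  Fresh mark = mark t ≡ 1 × (∀ v → v < n → v ≢ t → mark v ≡ 0)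

  scan-start : ∀ {g val mark par dir} → Flow Separating g val → Fresh mark → Scan g val mark par dir 0
  scan-start {mark = mark} fl (root , fresh) = record
    { flow    = fl
    ; tree    = record
      { root   = root
      ; unique = λ v v<n eq → only v v<n λ eq′ → 0≢1+n (trans (sym eq′) eq)
      ; arc    = λ v v<n 2≤ → case only v v<n (λ eq → case subst (2 ≤_) eq 2≤ of λ ()) of
                   λ { refl → contradiction (subst (2 ≤_) root 2≤) λ { (s≤s ()) } }
      }
    ; e≤m     = z≤n
    ; no-sink = λ v v<n v≢0 _ → only v v<n v≢0
    ; closed  = λ _ ()
    ; depth   = depth
    }
    where
    only : ∀ v → v < n → mark v ≢ 0 → v ≡ t
    only v v<n v≢0 with v ≟ t
    ... | yes v≡t = v≡t
    ... | no  v≢t = contradiction (fresh v v<n v≢t) v≢0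
    unmarked<n : suc (unmarked mark) ≤ n
    unmarked<n = begin
      suc (unmarked mark)                       ≡⟨ +-comm 1 _ ⟩
      unmarked mark + (λ _ → 1) t
        ≡⟨ ∑-exchange n _ (λ _ → 1) t<n (λ v v<n t≢v → cong (indicator ∘ not ∘ nonzero) (fresh v v<n (t≢v ∘ sym))) ⟩
      ∑ n (λ _ → 1) + indicator (not (nonzero (mark t)))
        ≡⟨ cong (λ x → ∑ n (λ _ → 1) + indicator (not (nonzero x))) root ⟩
      ∑ n (λ _ → 1) + 0                         ≡⟨ +-identityʳ _ ⟩
      ∑ n (λ _ → 1)                             ≤⟨ ∑-≤-* n (λ _ _ → ≤-refl) ⟩
      n * 1                                     ≡⟨ *-identityʳ n ⟩
      n                                         ∎
      where open ≤-Reasoning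
    depth : ∀ v → v < n → mark v + unmarked mark ≤ n
    depth v v<n with v ≟ t
    ... | yes refl rewrite root = unmarked<n
    ... | no  v≢t  rewrite fresh v v<n v≢t = <⇒≤ unmarked<n

  Blocked : (g mark : ℕ → ℕ) → Bool → ℕ → Set
  Blocked g mark d e = mark (src d e) ≢ 0 → cap g d e ≢ 0 → mark (dst d e) ≢ 0

  scan-next : ∀ {g val mark par dir e} → Scan g val mark par dir e → e < m →
    Blocked g mark true e → Blocked g mark false e → Scan g val mark par dir (suc e)
  scan-next {g} {mark = mark} {e = e} sc e<m fwd bwd = record
    { flow = flow ; tree = tree ; e≤m = e<m ; no-sink = no-sink ; depth = depth ; closed = closed′ }
    where
    open Scan sc
    closed′ : ∀ i → i < suc e → ∀ d → Blocked g mark d i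
    closed′ i i<1+e with i ≟ e
    ... | no  i≢e = closed i (≤∧≢⇒< (≤-pred i<1+e) i≢e)
    ... | yes refl = λ { true → fwd ; false → bwd }

  scan-visit : ∀ {g val mark par dir e₀} d e → Scan g val mark par dir e₀ → e < m →
    mark (src d e) ≢ 0 → mark (dst d e) ≡ 0 → cap g d e ≢ 0 → live (dst d e) ≡ 0 →
    Scan g val (set mark (dst d e) (suc (mark (src d e)))) (set par (dst d e) e) (set dir (dst d e) (dirCode d)) 0
  scan-visit {g} {mark = mark} d e sc e<m a≢0 b≡0 c live≡0 = record
    { flow    = flow
    ; tree    = tree-extend d e tree e<m a≢0 b≡0 c
    ; e≤m     = z≤n
    ; no-sink = no-sink′
    ; closed  = λ _ ()
    ; depth   = depth′
    }
    where
    open Scan sc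
    b = dst d e
    x = suc (mark (src d e))
    mark′ = set mark b x
    no-sink′ : ∀ v → v < n → mark′ v ≢ 0 → live v ≢ 0 → v ≡ t
    no-sink′ v v<n v≢0 live-v with b ≟ v
    ... | yes refl = contradiction live≡0 live-v
    ... | no  b≢v  = no-sink v v<n (λ eq → v≢0 (trans (set-other mark x b≢v) eq)) live-v
    count : suc (unmarked mark′) ≡ unmarked mark
    count = unmarked-set mark (dst<n d e e<m) b≡0 (λ ())
    depth′ : ∀ v → v < n → mark′ v + unmarked mark′ ≤ n
    depth′ v v<n with b ≟ v
    ... | yes refl rewrite set-same mark b x =
      ≤-trans (≤-reflexive (trans (sym (+-suc (mark (src d e)) _)) (cong (mark (src d e) +_) count)))
              (depth (src d e) (src<n d e e<m))
    ... | no  b≢v  rewrite set-other mark x b≢v =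
      ≤-trans (+-monoʳ-≤ (mark v) (≤-trans (n≤1+n _) (≤-reflexive count))) (depth v v<n)

  scan-end : ∀ {g val mark par dir} → Scan g val mark par dir m → MinCut Separating val (nonzero ∘ mark)
  scan-end {g} {mark = mark} sc = saturated⇒MinCut (nonzero ∘ mark) flow
    (record { inside = cong nonzero (Tree.root tree) ; outside = outside′ }) sat
    where
    open Scan sc
    outside′ : ∀ v → v < n → live v ≢ 0 → v ≢ t → nonzero (mark v) ≡ false
    outside′ v v<n live-v v≢t with mark v in eq
    ... | zero  = refl
    ... | suc _ = contradiction (no-sink v v<n (λ v≡0 → 0≢1+n (trans (sym v≡0) eq)) live-v) v≢t
    sat : ∀ e → e < m → ∀ d → nonzero (mark (src d e)) ≡ true → nonzero (mark (dst d e)) ≡ false → cap g d e ≡ 0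
    sat e e<m d a b with cap g d e ≟ 0
    ... | yes c≡0 = c≡0
    ... | no  c≢0 = contradiction (nonzero-false b) (closed e e<m d (nonzero⇒≢0 a) c≢0)

-- Rounds of the algorithm

module Rounds {ℓ} (n m : ℕ) (A B : ℕ → ℕ) (terminal : ℕ → ℕ) (Small Large : ℕ → Set ℓ) where

  open Network n m A B

  record Isolated (live out : ℕ → ℕ) (s d : ℕ) : Set ℓ where
    field
      large   : Large d
      minimal : ∀ X → Isolates n live s X → d ≤ δ X
      cut     : ∃[ R ] Isolates n live s R × (∀ e → e < m → crosses R e ≡ true → out e ≢ 0)

  Apart : ℕ → ℕ → Set ℓ
  Apart s t = ∃[ X ] X s ≢ X t × Small (δ X)

  -- `Apart` speaks of cuts of the whole graph and not of the live set, so it survives a drop.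
  -- Minimality in `isolated` depends on the live set, which is why a drop sets `i` back to 0 and
  -- erases `out`. In `total` an edge counts once for every recorded cut through it.
  record Progress (live out : ℕ → ℕ) (i : ℕ) : Set ℓ where
    field
      i≤n      : i ≤ n
      subset   : ∀ v → v < n → live v ≢ 0 → terminal v ≢ 0
      apart    : ∀ s t → s < n → t < n → terminal s ≢ 0 → terminal t ≢ 0 → s ≢ t →
                 live s ≡ 0 ⊎ live t ≡ 0 → Apart s t
      d        : ℕ → ℕ
      isolated : ∀ s → s < i → live s ≢ 0 → Isolated live out s (d s)
      total    : ∑ m out ≡ ∑ i (λ s → if nonzero (live s) then d s else 0)

  progress-start : ∀ {live out} → (∀ v → v < n → live v ≡ terminal v) → (∀ e → e < m → out e ≡ 0) →
    Progress live out 0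
  progress-start {live} live≡ out≡0 = record
    { i≤n      = z≤n
    ; subset   = λ v v<n v≢0 eq → v≢0 (trans (live≡ v v<n) eq)
    ; apart    = λ { s t s<n t<n s≢0 _ _ (inj₁ eq) → contradiction (trans (sym (live≡ s s<n)) eq) s≢0
                   ; s t s<n t<n _ t≢0 _ (inj₂ eq) → contradiction (trans (sym (live≡ t t<n)) eq) t≢0 }
    ; d        = λ _ → 0
    ; isolated = λ _ ()
    ; total    = ∑-zero m out≡0
    }

  progress-skip : ∀ {live out i} → Progress live out i → i < n → live i ≡ 0 → Progress live out (suc i)
  progress-skip {live} {out} {i} pr i<n dead = record
    { i≤n = i<n ; subset = subset ; apart = apart ; d = d
    ; isolated = isolated′
    ; total = trans total (sym (trans (cong (λ x → S + (if nonzero x then d i else 0)) dead) (+-identityʳ S)))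
    }
    where
    open Progress pr
    S = ∑ i (λ s → if nonzero (live s) then d s else 0)
    isolated′ : ∀ s → s < suc i → live s ≢ 0 → Isolated live out s (d s)
    isolated′ s s<1+i live-s with s ≟ i
    ... | yes refl = contradiction dead live-s
    ... | no  s≢i  = isolated s (≤∧≢⇒< (≤-pred s<1+i) s≢i) live-s

  -- A pair that only now has a dropped member consists of `i` and a vertex that is still live, and
  -- `R` separates `i` from all of these.
  progress-drop : ∀ {live out out′ i val R} → Progress live out i → i < n → live i ≢ 0 →
    MinCut (Isolates n live i) val R → Small val → (∀ e → e < m → out′ e ≡ 0) →
    Progress (set live i 0) out′ 0
  progress-drop {live} {i = i} {val} {R} pr i<n live-i mc small out≡0 = record
    { i≤n = z≤n
    ; subset = subset′
    ; apart = apart′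
    ; d = λ _ → 0
    ; isolated = λ _ ()
    ; total = ∑-zero m out≡0
    }
    where
    open Progress pr
    open MinCut mc
    open Isolates separates
    subset′ : ∀ v → v < n → set live i 0 v ≢ 0 → terminal v ≢ 0
    subset′ v v<n v≢0 with i ≟ v
    ... | yes refl = contradiction (set-same live i 0) v≢0
    ... | no  i≢v  = subset v v<n (λ eq → v≢0 (trans (set-other live 0 i≢v) eq))
    smallR : Small (δ R)
    smallR = subst Small (sym δ≡value) small
    i|_ : ∀ t → t < n → live t ≢ 0 → t ≢ i → R i ≢ R t
    (i| t) t<n live-t t≢i eq = true≢false (trans (sym inside) (trans eq (outside t t<n live-t t≢i)))
    apart′ : ∀ s t → s < n → t < n → terminal s ≢ 0 → terminal t ≢ 0 → s ≢ t →
      set live i 0 s ≡ 0 ⊎ set live i 0 t ≡ 0 → Apart s t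
    apart′ s t s<n t<n s∈T t∈T s≢t dead with live s ≟ 0 | live t ≟ 0
    ... | yes s≡0 | _       = apart s t s<n t<n s∈T t∈T s≢t (inj₁ s≡0)
    ... | no _    | yes t≡0 = apart s t s<n t<n s∈T t∈T s≢t (inj₂ t≡0)
    ... | no s≢0  | no t≢0 with i ≟ s | i ≟ t
    ...   | yes refl | _        = R , (i| t) t<n t≢0 (s≢t ∘ sym) , smallR
    ...   | no _     | yes refl = R , (i| s) s<n s≢0 s≢t ∘ sym , smallR
    ...   | no i≢s   | no i≢t with dead
    ...     | inj₁ eq = contradiction (trans (sym (set-other live 0 i≢s)) eq) s≢0
    ...     | inj₂ eq = contradiction (trans (sym (set-other live 0 i≢t)) eq) t≢0

  progress-keep : ∀ {live out out′ i val R} → Progress live out i → i < n → live i ≢ 0 →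
    MinCut (Isolates n live i) val R → Large val →
    (∀ e → e < m → out′ e ≡ out e + indicator (crosses R e)) → Progress live out′ (suc i)
  progress-keep {live} {out} {out′} {i} {val} {R} pr i<n live-i mc large out≡ = record
    { i≤n = i<n ; subset = subset ; apart = apart
    ; d = d′
    ; isolated = isolated′
    ; total = total′
    }
    where
    open Progress pr
    open MinCut mc
    d′ = set d i val
    isolated′ : ∀ s → s < suc i → live s ≢ 0 → Isolated live out′ s (d′ s)
    isolated′ s s<1+i live-s with i ≟ s
    ... | yes refl rewrite set-same d i val = record
      { large = large ; minimal = minimal
      ; cut = R , separates , λ e e<m cr eq → 1+n≢0 (trans (+-comm 1 (out e))
          (trans (cong (λ b → out e + indicator b) (sym cr)) (trans (sym (out≡ e e<m)) eq)))
      }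
    ... | no i≢s rewrite set-other d val i≢s = record
      { large = I.large ; minimal = I.minimal
      ; cut = proj₁ I.cut , proj₁ (proj₂ I.cut) ,
              λ e e<m cr eq → proj₂ (proj₂ I.cut) e e<m cr (m+n≡0⇒m≡0 (out e) (trans (sym (out≡ e e<m)) eq))
      }
      where module I = Isolated (isolated s (≤∧≢⇒< (≤-pred s<1+i) (i≢s ∘ sym)) live-s)
    open ≡-Reasoning
    total′ : ∑ m out′ ≡ ∑ (suc i) (λ s → if nonzero (live s) then d′ s else 0)
    total′ = begin
      ∑ m out′                                     ≡⟨ ∑-cong m out≡ ⟩
      ∑ m (λ e → out e + indicator (crosses R e))  ≡⟨ ∑-+ m out (indicator ∘ crosses R) ⟩
      ∑ m out + δ R                                ≡⟨ cong₂ _+_ total δ≡value ⟩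
      ∑ i (λ s → if nonzero (live s) then d s else 0) + val
        ≡⟨ cong₂ _+_ (∑-cong i λ s s<i → cong (if nonzero (live s) then_else 0) (sym (set-other d val (>⇒≢ s<i))))
                     (trans (sym (set-same d i val)) (cong (if_then d′ i else 0) (sym (nonzero-true live-i)))) ⟩
      ∑ (suc i) (λ s → if nonzero (live s) then d′ s else 0) ∎

  liveCount : (ℕ → ℕ) → ℕ
  liveCount live = ∑ n (indicator ∘ nonzero ∘ live)

  liveCount-drop : ∀ {live i} → i < n → live i ≢ 0 → liveCount (set live i 0) < liveCount live
  liveCount-drop {live} {i} i<n live-i = ≤-reflexive (begin
    suc (liveCount (set live i 0))                          ≡⟨ +-comm 1 _ ⟩
    liveCount (set live i 0) + 1
      ≡⟨ cong (λ b → liveCount (set live i 0) + indicator b) (sym (nonzero-true live-i)) ⟩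
    liveCount (set live i 0) + indicator (nonzero (live i))
      ≡⟨ ∑-exchange n _ _ i<n (λ v _ i≢v → cong (indicator ∘ nonzero) (set-other live 0 i≢v)) ⟩
    liveCount live + indicator (nonzero (set live i 0 i))
      ≡⟨ cong (λ x → liveCount live + indicator (nonzero x)) (set-same live i 0) ⟩
    liveCount live + 0                                      ≡⟨ +-identityʳ _ ⟩
    liveCount live                                          ∎)
    where open ≡-Reasoning

  liveCount≤n : ∀ live → liveCount live ≤ n
  liveCount≤n live = ≤-trans (∑-≤-* n λ v _ → indicator≤1 (nonzero (live v))) (≤-reflexive (*-identityʳ n))

-- The program

-- small decides whether the value in array 12 is at most γ (k ∸ 1).
module Algorithm (Q : Set) (test : Q → ℕ → ℕ → Bool) (small : RAM.Expr Q test) where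

  open RAM Q test
  open HoareLogic Q test

  infix 8 _!
  _! : ℕ → Expr
  x ! = x [ const 0 ]

  infix 5 _:=_
  _:=_ : ℕ → Expr → Program
  x := e = x [ const 0 ]≔ e

  -- The input indicator of the terminals is itself turned into the live set. Arrays from 6 on are
  -- initially 0, so neither `answer` nor `root` has to be initialised before the first round.
  #vertices #edges tailOf headOf liveness answer flow mark par dir edge value root cur index : ℕ
  #vertices = 0
  #edges    = 1
  tailOf    = 3
  headOf    = 4
  liveness  = 5
  answer    = 6
  flow      = 7
  mark      = 8
  par       = 9
  dir       = 10
  edge      = 11
  value     = 12
  root      = 13
  cur       = 14
  index     = 15

  fill : ℕ → ℕ → ℕ → Program
  fill x len v =
    index := const 0 ⨾
    whilenz (len ! ⊖ index !) (
      x [ index ! ]≔ const v ⨾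
      index := const 1 ⊕ index !)

  -- Old entries of `par` and `dir` are harmless: they are read only at vertices of mark at least 2,
  -- where `visit` has renewed them.
  restart : Program
  restart =
    fill mark #vertices 0 ⨾
    mark [ root ! ]≔ const 1 ⨾
    edge := const 0

  traceBack : Program
  traceBack =
    ifnz (dir [ cur ! ])
      (flow [ par [ cur ! ] ]≔ const 1 ⊕ flow [ par [ cur ! ] ] ⨾
       cur := tailOf [ par [ cur ! ] ])
      (flow [ par [ cur ! ] ]≔ flow [ par [ cur ! ] ] ⊖ const 1 ⨾
       cur := headOf [ par [ cur ! ] ])

  augment : Program
  augment =
    whilenz (mark [ cur ! ] ⊖ const 1) traceBack ⨾
    value := const 1 ⊕ value ! ⨾
    restart

  srcE dstE capE : Bool → Expr
  srcE true  = tailOf [ edge ! ]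
  srcE false = headOf [ edge ! ]
  dstE true  = headOf [ edge ! ]
  dstE false = tailOf [ edge ! ]
  capE true  = const 2 ⊖ flow [ edge ! ]
  capE false = flow [ edge ! ]

  -- One summand for each way in which an arc can fail to extend the tree: unmarked source, marked
  -- target, no residual capacity. The value is 0 exactly if none of them occurs.
  blocked : Bool → Expr
  blocked d = (const 1 ⊖ mark [ srcE d ]) ⊕ mark [ dstE d ] ⊕ (const 1 ⊖ capE d)

  -- The newly marked vertex is not the root, which is marked from the start; if it is live, it is a
  -- sink, and the search turns into an augmentation.
  visit : Bool → Program
  visit d =
    mark [ dstE d ]≔ const 1 ⊕ mark [ srcE d ] ⨾
    par [ dstE d ]≔ edge ! ⨾
    dir [ dstE d ]≔ const (dirCode d) ⨾
    ifnz (liveness [ dstE d ])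
      (cur := dstE d ⨾ augment)
      (edge := const 0)

  scan : Program
  scan =
    ifnz (blocked true)
      (ifnz (blocked false)
        (edge := const 1 ⊕ edge !)
        (visit false))
      (visit true)

  minCut : Program
  minCut =
    fill flow #edges 1 ⨾
    value := const 0 ⨾
    restart ⨾
    whilenz (#edges ! ⊖ edge !) scan

  unmarkedTail unmarkedHead : Expr
  unmarkedTail = const 1 ⊖ mark [ tailOf [ edge ! ] ]
  unmarkedHead = const 1 ⊖ mark [ headOf [ edge ! ] ]

  -- answer counts the recorded cuts through each edge, so it sums to their total size.
  recordCut : Program
  recordCut =
    edge := const 0 ⨾
    whilenz (#edges ! ⊖ edge !) (
      answer [ edge ! ]≔ answer [ edge ! ] ⊕ ((unmarkedTail ⊖ unmarkedHead) ⊕ (unmarkedHead ⊖ unmarkedTail)) ⨾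
      edge := const 1 ⊕ edge !)

  dropRoot : Program
  dropRoot =
    liveness [ root ! ]≔ const 0 ⨾
    fill answer #edges 0 ⨾
    root := const 0

  nextRoot : Program
  nextRoot = root := const 1 ⊕ root !

  algorithm : Program
  algorithm =
    whilenz (#vertices ! ⊖ root !) (
      ifnz (liveness [ root ! ])
        (minCut ⨾ ifnz small dropRoot (recordCut ⨾ nextRoot))
        nextRoot)

  -- The numerals are the costs of the loop-free parts.
  fillTime : ℕ → ℕ
  fillTime N = 3 + suc N * 16

  restartTime : ℕ → ℕ
  restartTime N = fillTime N + 7

  traceTime : ℕ → ℕ
  traceTime N = suc N * 42

  augmentTime : ℕ → ℕ
  augmentTime N = traceTime N + (6 + restartTime N)

  visitTime : ℕ → ℕ
  visitTime N = 26 + (5 + augmentTime N + 3)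

  scanTime : ℕ → ℕ
  scanTime N = 20 + (18 + (6 + visitTime N) + visitTime N)

  -- The first factor of the product is a bound on `weight`, increased by one for the final test of
  -- the loop.
  minCutTime : ℕ → ℕ → ℕ
  minCutTime N M = fillTime M + (3 + (restartTime N +
    suc (M * suc (N * suc M + M) + (N * suc M + M)) * (6 + scanTime N)))

  recordTime : ℕ → ℕ
  recordTime M = 3 + suc M * 46

  dropTime : ℕ → ℕ
  dropTime M = 4 + (fillTime M + 3)

  algorithmTime : ℕ → ℕ → ℕ
  algorithmTime N M = suc (N * suc N + N) *
    (10 + (minCutTime N M + (suc (cost small) + (dropTime M + (recordTime M + 6))) + 6))

  -- Correctness and running time of the program

  update-other : ∀ σ {x} i v {z} → x ≢ z → update σ x i v z ≡ σ z
  update-other σ {x} i v {z} x≢z with x ≡ᵇ z | ≡ᵇ⇒≡ x z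
  ... | true  | eq = contradiction (eq _) x≢z
  ... | false | _  = refl

  update-same : ∀ σ x i v → update σ x i v x ≡ set (σ x) i v
  update-same σ x i v with x ≡ᵇ x | ≡⇒≡ᵇ x x refl
  ... | true | _ = refl

  fill-run : ∀ {σ} x len v → x ≢ index → len ≢ index → len ≢ x →
    Run (fill x len v) σ (fillTime (σ len 0)) λ τ →
      (∀ z → x ≢ z → index ≢ z → τ z ≡ σ z) × (∀ i → i < σ len 0 → τ x i ≡ v)
  fill-run {σ} x len v x≢i len≢i len≢x = run-assign-seq (run-mono
    (run-while I body {N} {N} ≤-refl
      ( refl
      , (λ z x≢z i≢z → update-other σ 0 0 i≢z)
      , λ i ()))
    λ { {τ} (μ , (_ , same , filled) , exit) → same , λ i i<N → filled i (≤-trans i<N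
      (≤-trans (≤-reflexive (sym (cong-app (same len (len≢x ∘ sym) (len≢i ∘ sym)) 0))) (m∸n≡0⇒m≤n exit))) })
    where
    N = σ len 0
    I : ℕ → State → Set
    I μ τ = τ index 0 + μ ≡ N × (∀ z → x ≢ z → index ≢ z → τ z ≡ σ z) × (∀ i → i < τ index 0 → τ x i ≡ v)
    body : ∀ μ τ → I μ τ → τ len 0 ∸ τ index 0 ≢ 0 →
      Run (x [ index ! ]≔ const v ⨾ index := const 1 ⊕ index !) τ 10 λ τ′ → ∃[ μ′ ] μ′ < μ × I μ′ τ′
    body zero τ (sum≡N , same , _) go = contradiction
      (m≤n⇒m∸n≡0 (≤-reflexive (trans (cong-app (same len (len≢x ∘ sym) (len≢i ∘ sym)) 0) (trans (sym sum≡N) (+-identityʳ _))))) go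
    body (suc μ) τ (sum≡N , same , filled) go = run-assign-seq (run-assign (μ , ≤-refl
      , trans (cong (λ y → suc (y + μ)) ix) (trans (sym (+-suc _ μ)) sum≡N)
      , (λ z x≢z i≢z → trans (update-other τ₁ 0 _ i≢z) (trans (update-other τ j v x≢z) (same z x≢z i≢z)))
      , filled′))
      where
      j = τ index 0
      τ₁ = update τ x j v
      ix : τ₁ index 0 ≡ j
      ix = cong-app (update-other τ j v x≢i) 0
      filled′ : ∀ i → i < suc (τ₁ index 0) → update τ₁ index 0 (suc (τ₁ index 0)) x i ≡ v
      filled′ i i<1+j rewrite cong-app (update-other τ₁ 0 (suc (τ₁ index 0)) {x} (x≢i ∘ sym)) i | cong-app (update-same τ x j v) i
        with j ≟ i
      ... | yes refl = set-same (τ x) j v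
      ... | no  j≢i  rewrite set-other (τ x) v j≢i = filled i (≤∧≢⇒< (≤-pred (subst (λ y → i < suc y) ix i<1+j)) (j≢i ∘ sym))

  module _ (n m k : ℕ) (A B : ℕ → ℕ)
    (A<n : ∀ e → e < m → A e < n) (B<n : ∀ e → e < m → B e < n) where

    open Network n m A B

    -- The parameters are the contents of the arrays and not the state. After an update of some
    -- other array these contents compute to the previous ones, so a proof about the old state is
    -- literally a proof about the new one.
    record InputAre (n′ m′ k′ : ℕ) (A′ B′ : ℕ → ℕ) : Set where
      field
        n≡ : n′ ≡ n
        m≡ : m′ ≡ m
        k≡ : k′ ≡ k
        A≡ : A′ ≡ A
        B≡ : B′ ≡ B

    Input : State → Set
    Input σ = InputAre (σ 0 0) (σ 1 0) (σ 2 0) (σ 3) (σ 4)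

    module _ (live out : ℕ → ℕ) (t : ℕ) (t<n : t < n) where

      open Augmentation n m A B A<n B<n live t t<n

      record FrameAre (n′ m′ k′ : ℕ) (A′ B′ live′ out′ : ℕ → ℕ) (t′ : ℕ) : Set where
        field
          inputs : InputAre n′ m′ k′ A′ B′
          live≡ : live′ ≡ live
          out≡  : out′ ≡ out
          root≡ : t′ ≡ t
        open InputAre inputs public

      Frame : State → Set
      Frame σ = FrameAre (σ 0 0) (σ 1 0) (σ 2 0) (σ 3) (σ 4) (σ 5) (σ 6) (σ 13 0)

      open FrameAre

      Scanning : State → Set
      Scanning σ = Scan (σ flow) (σ value 0) (σ mark) (σ par) (σ dir) (σ edge 0)

      frame-fill : ∀ {σ τ x} → 6 < x → x ≢ root → (∀ z → x ≢ z → index ≢ z → τ z ≡ σ z) → Frame σ → Frame τ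
      frame-fill {σ} {τ} {x} 6<x x≢root same fr = record
        { inputs = record
          { n≡ = trans (cong-app (low 0 z≤n) 0) (n≡ fr)
          ; m≡ = trans (cong-app (low 1 (s≤s z≤n)) 0) (m≡ fr)
          ; k≡ = trans (cong-app (low 2 (s≤s (s≤s z≤n))) 0) (k≡ fr)
          ; A≡ = trans (low 3 (s≤s (s≤s (s≤s z≤n)))) (A≡ fr)
          ; B≡ = trans (low 4 (s≤s (s≤s (s≤s (s≤s z≤n))))) (B≡ fr)
          }
        ; live≡ = trans (low 5 (s≤s (s≤s (s≤s (s≤s (s≤s z≤n)))))) (live≡ fr)
        ; out≡  = trans (low 6 ≤-refl) (out≡ fr)
        ; root≡ = trans (cong-app (same 13 x≢root (λ ())) 0) (root≡ fr)
        }
        where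
        low : ∀ z → z ≤ 6 → τ z ≡ σ z
        low z z≤6 = same z (λ { refl → <-irrefl refl (≤-trans 6<x z≤6) }) (λ { refl → <-irrefl refl (≤-trans (m≤m+n 7 8) z≤6) })

      restart-run : ∀ {σ val} → Frame σ → σ value 0 ≡ val → Flow Separating (σ flow) val →
        Run restart σ (restartTime n) λ τ →
          Frame τ × τ edge 0 ≡ 0 × τ value 0 ≡ val × Scan (τ flow) val (τ mark) (τ par) (τ dir) 0
      restart-run {σ} fr refl fl = run-seq
        (subst (λ N → Run (fill mark #vertices 0) σ (fillTime N) λ τ →
            (∀ z → mark ≢ z → index ≢ z → τ z ≡ σ z) × (∀ i → i < N → τ mark i ≡ 0))
          (n≡ fr) (fill-run mark #vertices 0 (λ ()) (λ ()) (λ ())))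
        λ { {τ} (same , zeroed) → run-assign-seq (run-assign
          ( frame-fill {x = mark} (m≤m+n 7 1) (λ ()) same fr
          , refl
          , cong-app (same value (λ ()) (λ ())) 0
          , scan-start (subst (λ g → Flow Separating g _) (sym (same flow (λ ()) (λ ()))) fl)
              (subst (λ r → Fresh (set (τ mark) r 1)) (sym (trans (cong-app (same root (λ ()) (λ ())) 0) (root≡ fr)))
                ( set-same (τ mark) t 1
                , λ v v<n v≢t → trans (set-other (τ mark) 1 (v≢t ∘ sym)) (zeroed v v<n))))) }

      -- The part of `Tree` that the pushes do not destroy. It identifies the vertex of mark 1 at
      -- which the walk back stops.
      OneRoot : (ℕ → ℕ) → Set
      OneRoot rank = ∀ v → v < n → rank v ≡ 1 → v ≡ t

      TraceI : ℕ → ℕ → State → Set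
      TraceI val μ σ = Frame σ × σ value 0 ≡ val × OneRoot (σ mark) × μ ≡ σ mark (σ cur 0) ×
        Trace val (σ mark) (σ par) (σ dir) (σ flow) (σ cur 0)

      traceBack-run : ∀ val μ σ → TraceI val μ σ → σ mark (σ cur 0) ∸ 1 ≢ 0 →
        Run traceBack σ 36 λ τ → ∃[ μ′ ] μ′ < μ × TraceI val μ′ τ
      traceBack-run val _ σ (fr , val≡ , one , refl , tr) go = run-if
        (λ dir≢0 → run-assign-seq (run-assign (moved true (A≡ fr) (nonzero-true dir≢0))))
        (λ dir≡0 → run-assign-seq (run-assign (moved false (B≡ fr) (cong nonzero dir≡0))))
        where
        c = σ cur 0
        2≤c : 2 ≤ σ mark c
        2≤c = ≰⇒> (λ c≤1 → go (m≤n⇒m∸n≡0 c≤1))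
        moved : ∀ d {ends} → ends ≡ src d → nonzero (σ dir c) ≡ d →
          ∃[ μ′ ] μ′ < σ mark c × Frame σ × σ value 0 ≡ val × OneRoot (σ mark) × μ′ ≡ σ mark (ends (σ par c)) ×
            Trace val (σ mark) (σ par) (σ dir) (push (σ flow) d (σ par c)) (ends (σ par c))
        moved d refl refl with trace-step tr 2≤c
        ... | rank , tr′ = _ , ≤-reflexive (sym rank) , fr , val≡ , one , refl , tr′

      augment-run : ∀ {σ val} → TraceI val (σ mark (σ cur 0)) σ → σ mark (σ cur 0) ≤ n →
        Run augment σ (augmentTime n) λ τ →
          Frame τ × τ edge 0 ≡ 0 × τ value 0 ≡ suc val × Scan (τ flow) (suc val) (τ mark) (τ par) (τ dir) 0
      augment-run {σ} {val} inv depth = run-seq (run-while (TraceI val) (traceBack-run val) depth inv)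
        λ { {τ} (μ , (fr , val≡ , one , _ , tr) , exit) → run-assign-seq
          (restart-run fr (cong suc val≡)
            (trace-end (subst (Trace val (τ mark) (τ par) (τ dir) (τ flow)) (at-root τ one tr exit) tr))) }
        where
        at-root : ∀ τ → OneRoot (τ mark) → Trace val (τ mark) (τ par) (τ dir) (τ flow) (τ cur 0) →
          τ mark (τ cur 0) ∸ 1 ≡ 0 → τ cur 0 ≡ t
        at-root τ one tr exit = one (τ cur 0) (Trace.cur<n tr)
          (≤-antisym (m∸n≡0⇒m≤n exit) (n≢0⇒n>0 (Trace.reached tr)))

      spread : ℕ
      spread = n * suc m + m

      -- Lexicographic in the missing augmentations, the unmarked vertices and the edges still to be scanned.
      weight : ℕ → (ℕ → ℕ) → ℕ → ℕ
      weight val rank e = (m ∸ val) * suc spread + (unmarked rank * suc m + (m ∸ e))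

      digits≤spread : ∀ rank e → unmarked rank * suc m + (m ∸ e) ≤ spread
      digits≤spread rank e = +-mono-≤ (*-monoˡ-≤ (suc m) (unmarked≤n rank)) (m∸n≤m m e)

      ScanI : ℕ → State → Set
      ScanI μ σ = Frame σ × Scanning σ × μ ≡ weight (σ value 0) (σ mark) (σ edge 0)

      -- The set containing only `t` bounds the value of every flow by `m`, and with it the number
      -- of augmentations.
      separating-singleton : Separating (t ≡ᵇ_)
      separating-singleton = record { inside = inside ; outside = λ v _ _ v≢t → outside v v≢t }
        where
        inside : (t ≡ᵇ t) ≡ true
        inside with t ≡ᵇ t | ≡⇒≡ᵇ t t refl
        ... | true | _ = refl
        outside : ∀ v → v ≢ t → (t ≡ᵇ v) ≡ false
        outside v v≢t with t ≡ᵇ v | ≡ᵇ⇒≡ t v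
        ... | true  | eq = contradiction (sym (eq _)) v≢t
        ... | false | _  = refl

      augmented : ∀ {val rank₀ e₀ τ} →
        Frame τ × τ edge 0 ≡ 0 × τ value 0 ≡ suc val × Scan (τ flow) (suc val) (τ mark) (τ par) (τ dir) 0 →
        ∃[ μ′ ] μ′ < weight val rank₀ e₀ × ScanI μ′ τ
      augmented {val} {τ = τ} (fr , e≡ , val≡ , sc) =
        weight (τ value 0) (τ mark) (τ edge 0)
        , lex-< spread
            (subst (λ v → m ∸ v < m ∸ val) (sym val≡) (∸-monoʳ-< ≤-refl
              (≤-trans (Flow.value≤δ (Scan.flow sc) separating-singleton) (δ≤m (t ≡ᵇ_)))))
            (digits≤spread (τ mark) (τ edge 0))
        , fr
        , subst₂ (λ v e → Scan (τ flow) v (τ mark) (τ par) (τ dir) e) (sym val≡) (sym e≡) sc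
        , refl

      -- `ScanI` and `TraceI`, unfolded at the state that the assignments of `visit` produce, with
      -- `as` and `bs` for the arrays that give source and target. In this form one proof serves
      -- both directions; the trivial equations are components of `TraceI`.
      Visited : ℕ → State → (as bs : ℕ → ℕ) → Bool → Set
      Visited μ σ as bs d =
        (σ liveness b ≡ 0 → ∃[ μ′ ] μ′ < μ × Frame σ × Scan (σ flow) (σ value 0) rank′ par′ dir′ 0
                                      × μ′ ≡ weight (σ value 0) rank′ 0)
        × (σ liveness b ≢ 0 → (Frame σ × σ value 0 ≡ σ value 0 × OneRoot rank′ × rank′ b ≡ rank′ b ×
                                Trace (σ value 0) rank′ par′ dir′ (σ flow) b) × rank′ b ≤ n)
        where
        b = bs (σ edge 0)
        rank′ = set (σ mark) b (suc (σ mark (as (σ edge 0))))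
        par′ = set (σ par) b (σ edge 0)
        dir′ = set (σ dir) b (dirCode d)

      visited : ∀ d {as bs μ} {σ : State} → as ≡ src d → bs ≡ dst d → ScanI μ σ → σ edge 0 < m →
        σ mark (as (σ edge 0)) ≢ 0 → σ mark (bs (σ edge 0)) ≡ 0 → cap (σ flow) d (σ edge 0) ≢ 0 →
        Visited μ σ as bs d
      visited d {σ = σ} refl refl (fr , sc , refl) e<m a≢0 b≡0 c≢0 =
        (λ live≡0 → _
          -- The new mark lowers the middle digit, which outweighs the return of `edge` to 0.
          , +-monoʳ-< ((m ∸ σ value 0) * suc spread) (lex-< m (≤-reflexive fewer) ≤-refl)
          , fr
          , scan-visit d e sc e<m a≢0 b≡0 c≢0 (trans (sym (cong-app (live≡ fr) b)) live≡0)
          , refl)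
        , (λ live≢0 →
            ( fr , refl , Tree.unique tree′ , refl
            , trace-start (Scan.flow sc) tree′ b<n (λ eq → live≢0 (trans (cong-app (live≡ fr) b) eq))
                (λ b≡t → 0≢1+n (trans (sym b≡0) (trans (cong (σ mark) b≡t) (Tree.root (Scan.tree sc)))))
                (λ eq → 0≢1+n (trans (sym eq) same)))
            , (begin
              set (σ mark) b (suc (σ mark a)) b  ≡⟨ same ⟩
              suc (σ mark a)                     ≤⟨ s≤s (m≤m+n _ _) ⟩
              suc (σ mark a + unmarked (set (σ mark) b (suc (σ mark a)))) ≡⟨ sym (+-suc _ _) ⟩
              σ mark a + suc (unmarked (set (σ mark) b (suc (σ mark a)))) ≡⟨ cong (σ mark a +_) fewer ⟩
              σ mark a + unmarked (σ mark)       ≤⟨ Scan.depth sc a (src<n d e e<m) ⟩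
              n                                  ∎))
        where
        open ≤-Reasoning
        e = σ edge 0
        a = src d e
        b = dst d e
        b<n = dst<n d e e<m
        same = set-same (σ mark) b (suc (σ mark a))
        fewer = unmarked-set (σ mark) {x = suc (σ mark a)} b<n b≡0 (λ ())
        tree′ = tree-extend d e (Scan.tree sc) e<m a≢0 b≡0 c≢0

      free⇒ : ∀ x y z → (1 ∸ x) + y + (1 ∸ z) ≡ 0 → x ≢ 0 × y ≡ 0 × z ≢ 0
      free⇒ (suc x) zero (suc z) _  = (λ ()) , refl , λ ()
      free⇒ (suc x) y    zero    eq = contradiction (m+n≡0⇒n≡0 (0 ∸ x + y) eq) λ ()
      free⇒ (suc x) (suc y) z    eq = contradiction (m+n≡0⇒n≡0 (0 ∸ x) (m+n≡0⇒m≡0 _ eq)) λ ()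

      blocked⇒ : ∀ x y z → (1 ∸ x) + y + (1 ∸ z) ≢ 0 → x ≢ 0 → z ≢ 0 → y ≢ 0
      blocked⇒ zero    _    _       _  x≢0 _ = contradiction refl x≢0
      blocked⇒ (suc _) _    zero    _  _ z≢0 = contradiction refl z≢0
      blocked⇒ (suc x) zero (suc z) ≢0 _ _ _ = ≢0 (cong₂ (λ a b → a + 0 + b) (0∸n≡0 x) (0∸n≡0 z))
      blocked⇒ (suc _) (suc _) _    _  _ _ ()

      visit-run : ∀ d {μ σ} → ScanI μ σ → σ edge 0 < m → eval (blocked d) σ ≡ 0 →
        Run (visit d) σ (visitTime n) λ τ → ∃[ μ′ ] μ′ < μ × ScanI μ′ τ
      visit-run true {σ = σ} inv@(fr , sc , refl) e<m free
        with free⇒ (σ mark (σ tailOf (σ edge 0))) (σ mark (σ headOf (σ edge 0))) _ free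
      ... | a≢0 , b≡0 , c≢0 with visited true {σ = σ} (A≡ fr) (B≡ fr) inv e<m a≢0 b≡0 c≢0
      ...   | quiet , sink = run-assign-seq (run-assign-seq (run-assign-seq (run-if
        (λ live≢0 → run-assign-seq (run-mono (augment-run (proj₁ (sink live≢0)) (proj₂ (sink live≢0)))
          λ {τ} → augmented {σ value 0} {σ mark} {σ edge 0} {τ}))
        (λ live≡0 → run-assign (quiet live≡0)))))
      visit-run false {σ = σ} inv@(fr , sc , refl) e<m free
        with free⇒ (σ mark (σ headOf (σ edge 0))) (σ mark (σ tailOf (σ edge 0))) _ free
      ... | a≢0 , b≡0 , c≢0 with visited false {σ = σ} (B≡ fr) (A≡ fr) inv e<m a≢0 b≡0 c≢0
      ...   | quiet , sink = run-assign-seq (run-assign-seq (run-assign-seq (run-if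
        (λ live≢0 → run-assign-seq (run-mono (augment-run (proj₁ (sink live≢0)) (proj₂ (sink live≢0)))
          λ {τ} → augmented {σ value 0} {σ mark} {σ edge 0} {τ}))
        (λ live≡0 → run-assign (quiet live≡0)))))

      blocked-by : ∀ d {as bs} (σ : State) → as ≡ src d → bs ≡ dst d → let e = σ edge 0 in
        (1 ∸ σ mark (as e)) + σ mark (bs e) + (1 ∸ cap (σ flow) d e) ≢ 0 → Blocked (σ flow) (σ mark) d e
      blocked-by d σ refl refl = blocked⇒ (σ mark (src d (σ edge 0))) (σ mark (dst d (σ edge 0))) (cap (σ flow) d (σ edge 0))

      scan-run : ∀ μ σ → ScanI μ σ → σ #edges 0 ∸ σ edge 0 ≢ 0 →
        Run scan σ (scanTime n) λ τ → ∃[ μ′ ] μ′ < μ × ScanI μ′ τ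
      scan-run μ σ inv@(fr , sc , refl) go = run-if
        (λ fwd → run-if
          (λ bwd → run-assign
            ( _
            , +-monoʳ-< ((m ∸ σ value 0) * suc spread) (+-monoʳ-< (unmarked (σ mark) * suc m) (∸-monoʳ-< ≤-refl e<m))
            , fr
            , scan-next sc e<m (blocked-by true σ (A≡ fr) (B≡ fr) fwd) (blocked-by false σ (B≡ fr) (A≡ fr) bwd)
            , refl))
          (visit-run false inv e<m))
        (visit-run true inv e<m)
        where
        e<m : σ edge 0 < m
        e<m = ≰⇒> λ m≤e → go (m≤n⇒m∸n≡0 (≤-trans (≤-reflexive (m≡ fr)) m≤e))

      minCut-run : ∀ {σ} → Frame σ → Run minCut σ (minCutTime n m) λ τ →
        Frame τ × MinCut Separating (τ value 0) (nonzero ∘ τ mark)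
      minCut-run {σ} fr = run-seq
        (subst (λ M → Run (fill flow #edges 1) σ (fillTime M) λ τ →
            (∀ z → flow ≢ z → index ≢ z → τ z ≡ σ z) × (∀ i → i < M → τ flow i ≡ 1))
          (m≡ fr) (fill-run flow #edges 1 (λ ()) (λ ()) (λ ())))
        λ { (same , ones) → run-assign-seq (run-seq
          (restart-run (frame-fill {x = flow} ≤-refl (λ ()) same fr) refl (zero-flow ones))
          λ { {τ} (fr₁ , e≡ , val≡ , sc) → run-mono
            (run-while ScanI scan-run
              (+-mono-≤ (*-monoˡ-≤ (suc spread) (m∸n≤m m (τ value 0))) (digits≤spread (τ mark) (τ edge 0)))
              (fr₁ , subst₂ (λ v e → Scan (τ flow) v (τ mark) (τ par) (τ dir) e) (sym val≡) (sym e≡) sc , refl))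
            λ { {τ₂} (_ , (fr₂ , sc₂ , _) , exit) → fr₂ , scan-end (subst (Scan (τ₂ flow) (τ₂ value 0) (τ₂ mark) (τ₂ par) (τ₂ dir))
              (≤-antisym (Scan.e≤m sc₂) (≤-trans (≤-reflexive (sym (m≡ fr₂))) (m∸n≡0⇒m≤n exit))) sc₂) } }) }

    -- The two truncated differences add up to the absolute difference, which for values 0 and 1 is
    -- exclusive or.
    ⊖-xor : ∀ x y → ((1 ∸ x) ∸ (1 ∸ y)) + ((1 ∸ y) ∸ (1 ∸ x)) ≡ indicator (nonzero x xor nonzero y)
    ⊖-xor zero    zero    = refl
    ⊖-xor zero    (suc y) rewrite 0∸n≡0 y = refl
    ⊖-xor (suc x) zero    rewrite 0∸n≡0 x = refl
    ⊖-xor (suc x) (suc y) rewrite 0∸n≡0 x | 0∸n≡0 y = refl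

    recordCut-run : ∀ {σ} → Input σ → Run recordCut σ (recordTime m) λ τ →
      (∀ z → answer ≢ z → edge ≢ z → τ z ≡ σ z)
      × (∀ e → e < m → τ answer e ≡ σ answer e + indicator (crosses (nonzero ∘ σ mark) e))
    recordCut-run {σ} inp = run-assign-seq (run-mono
      (run-while I body ≤-refl (refl , (λ z _ e≢z → update-other σ 0 0 e≢z) , (λ e ()) , λ _ _ → refl))
      λ { {τ} (_ , (_ , same , done , _) , exit) → same , λ e e<m → done e (≤-trans e<m
            (≤-trans (≤-reflexive (sym (m-is τ same))) (m∸n≡0⇒m≤n exit))) })
      where
      open InputAre inp
      R = nonzero ∘ σ mark
      Same : State → Set
      Same τ = ∀ z → answer ≢ z → edge ≢ z → τ z ≡ σ z
      m-is : ∀ τ → Same τ → τ #edges 0 ≡ m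
      m-is τ same = trans (cong-app (same #edges (λ ()) (λ ())) 0) m≡
      I : ℕ → State → Set
      I μ τ = τ edge 0 + μ ≡ m × Same τ
            × (∀ e → e < τ edge 0 → τ answer e ≡ σ answer e + indicator (crosses R e))
            × (∀ e → τ edge 0 ≤ e → τ answer e ≡ σ answer e)
      body : ∀ μ τ → I μ τ → τ #edges 0 ∸ τ edge 0 ≢ 0 → Run _ τ 40 λ τ′ → ∃[ μ′ ] μ′ < μ × I μ′ τ′
      body zero τ (sum≡m , same , _) go = contradiction
        (m≤n⇒m∸n≡0 (≤-reflexive (trans (m-is τ same) (trans (sym sum≡m) (+-identityʳ _))))) go
      body (suc μ) τ (sum≡m , same , done , todo) go = run-assign-seq (run-assign
        ( μ , ≤-refl
        , trans (sym (+-suc j μ)) sum≡m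
        , (λ z a≢z e≢z → trans (update-other (update τ answer j new) 0 (suc j) e≢z)
                               (trans (update-other τ j new a≢z) (same z a≢z e≢z)))
        , done′ , todo′))
        where
        j = τ edge 0
        mark-at : ∀ f g → τ f ≡ σ f → σ f ≡ g → τ mark (τ f j) ≡ σ mark (g j)
        mark-at f g eq eq′ = cong₂ (λ h v → h v) (same mark (λ ()) (λ ())) (cong-app (trans eq eq′) j)
        x = τ mark (τ tailOf j)
        y = τ mark (τ headOf j)
        new = τ answer j + (((1 ∸ x) ∸ (1 ∸ y)) + ((1 ∸ y) ∸ (1 ∸ x)))
        new≡ : new ≡ σ answer j + indicator (crosses R j)
        new≡ = cong₂ _+_ (todo j ≤-refl) (trans (⊖-xor x y)
          (cong₂ (λ a b → indicator (nonzero a xor nonzero b))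
            (mark-at tailOf A (same tailOf (λ ()) (λ ())) A≡) (mark-at headOf B (same headOf (λ ()) (λ ())) B≡)))
        done′ : ∀ e → e < suc j → set (τ answer) j new e ≡ σ answer e + indicator (crosses R e)
        done′ e e<1+j with j ≟ e
        ... | yes refl = trans (set-same (τ answer) j new) new≡
        ... | no  j≢e  = trans (set-other (τ answer) new j≢e) (done e (≤∧≢⇒< (≤-pred e<1+j) (j≢e ∘ sym)))
        todo′ : ∀ e → suc j ≤ e → set (τ answer) j new e ≡ σ answer e
        todo′ e j<e = trans (set-other (τ answer) new (<⇒≢ j<e)) (todo e (<⇒≤ j<e))

    dropRoot-run : ∀ {σ} → Input σ → Run dropRoot σ (dropTime m) λ τ →
      Input τ × τ liveness ≡ set (σ liveness) (σ root 0) 0 × (∀ e → e < m → τ answer e ≡ 0) × τ root 0 ≡ 0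
    dropRoot-run {σ} inp = run-assign-seq (run-seq
      (subst (λ M → Run (fill answer #edges 0) σ₁ (fillTime M) λ τ →
          (∀ z → answer ≢ z → index ≢ z → τ z ≡ σ₁ z) × (∀ i → i < M → τ answer i ≡ 0))
        m≡ (fill-run answer #edges 0 (λ ()) (λ ()) (λ ())))
      λ { (same , zeroed) → run-assign
        ( record
          { n≡ = trans (cong-app (same 0 (λ ()) (λ ())) 0) n≡
          ; m≡ = trans (cong-app (same 1 (λ ()) (λ ())) 0) m≡
          ; k≡ = trans (cong-app (same 2 (λ ()) (λ ())) 0) k≡
          ; A≡ = trans (same 3 (λ ()) (λ ())) A≡
          ; B≡ = trans (same 4 (λ ()) (λ ())) B≡
          }
        , same liveness (λ ()) (λ ()) , zeroed , refl) })
      where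
      open InputAre inp
      σ₁ = update σ liveness (σ root 0) 0

    module _ {ℓ} (terminal : ℕ → ℕ) (Small Large : ℕ → Set ℓ)
      (small⇒ : ∀ σ → Input σ → eval small σ ≢ 0 → Small (σ value 0))
      (large⇒ : ∀ σ → Input σ → eval small σ ≡ 0 → Large (σ value 0)) where

      open Rounds n m A B terminal Small Large

      -- A drop starts over at vertex 0 but leaves fewer live vertices, so the measure is
      -- lexicographic in the live vertices and the roots still to come.
      RoundI : ℕ → State → Set ℓ
      RoundI μ σ = Input σ × Progress (σ liveness) (σ answer) (σ root 0)
                 × μ ≡ liveCount (σ liveness) * suc n + (n ∸ σ root 0)

      round-run : ∀ μ σ → RoundI μ σ → σ #vertices 0 ∸ σ root 0 ≢ 0 →
        Run (ifnz (liveness [ root ! ]) (minCut ⨾ ifnz small dropRoot (recordCut ⨾ nextRoot)) nextRoot)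
          σ (4 + (minCutTime n m + (suc (cost small) + (dropTime m + (recordTime m + 6))) + 6))
          λ τ → ∃[ μ′ ] μ′ < μ × RoundI μ′ τ
      round-run _ σ (inp , pr , refl) go = run-if
        (λ alive → run-seq
          (minCut-run (σ liveness) (σ answer) i i<n (record { inputs = inp ; live≡ = refl ; out≡ = refl ; root≡ = refl }))
          λ { {τ} (fr , mc) → run-if (drop τ alive fr mc) (keep τ alive fr mc) })
        (λ dead → run-assign (_ , advance , inp , progress-skip pr i<n dead , refl))
        where
        i = σ root 0
        i<n : i < n
        i<n = ≰⇒> λ n≤i → go (m≤n⇒m∸n≡0 (≤-trans (≤-reflexive (InputAre.n≡ inp)) n≤i))
        advance : liveCount (σ liveness) * suc n + (n ∸ suc i) < liveCount (σ liveness) * suc n + (n ∸ i)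
        advance = +-monoʳ-< (liveCount (σ liveness) * suc n) (∸-monoʳ-< ≤-refl i<n)
        μ = liveCount (σ liveness) * suc n + (n ∸ i)
        module _ (τ : State) (alive : σ liveness i ≢ 0) (fr : Frame (σ liveness) (σ answer) i i<n τ)
                 (mc : MinCut (Isolates n (σ liveness) i) (τ value 0) (nonzero ∘ τ mark)) where
          open FrameAre fr
          drop : eval small τ ≢ 0 → Run dropRoot τ (dropTime m) λ υ → ∃[ μ′ ] μ′ < μ × RoundI μ′ υ
          drop small≢0 = run-mono (dropRoot-run inputs) λ { {υ} (inp′ , live′ , zeroed , root′) →
            let live″ = trans live′ (cong₂ (λ f j → set f j 0) live≡ root≡) in
            _ , lex-< n (≤-trans (s≤s (≤-reflexive (cong liveCount live″))) (liveCount-drop {σ liveness} i<n alive))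
                        (m∸n≤m n (υ root 0))
            , inp′
            , subst₂ (λ l r → Progress l (υ answer) r) (sym live″) (sym root′)
                (progress-drop pr i<n alive mc (small⇒ τ inputs small≢0) zeroed)
            , refl }
          keep : eval small τ ≡ 0 → Run (recordCut ⨾ nextRoot) τ (recordTime m + 6) λ υ → ∃[ μ′ ] μ′ < μ × RoundI μ′ υ
          keep small≡0 = run-seq (recordCut-run inputs) λ { {υ} (same , added) →
            let live″ = trans (same liveness (λ ()) (λ ())) live≡
                root″ = trans (cong-app (same root (λ ()) (λ ())) 0) root≡ in
            run-assign
            ( _ , ≤-trans (s≤s (≤-reflexive (cong₂ (λ l r → liveCount l * suc n + (n ∸ suc r)) live″ root″))) advance
            , record
              { n≡ = trans (cong-app (same 0 (λ ()) (λ ())) 0) n≡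
              ; m≡ = trans (cong-app (same 1 (λ ()) (λ ())) 0) m≡
              ; k≡ = trans (cong-app (same 2 (λ ()) (λ ())) 0) k≡
              ; A≡ = trans (same 3 (λ ()) (λ ())) A≡
              ; B≡ = trans (same 4 (λ ()) (λ ())) B≡
              }
            , subst₂ (λ l r → Progress l (υ answer) (suc r)) (sym live″) (sym root″)
                (progress-keep pr i<n alive mc (large⇒ τ inputs small≡0)
                  λ e e<m → trans (added e e<m) (cong (_+ indicator (crosses (nonzero ∘ τ mark) e)) (cong-app out≡ e)))
            , refl) }

      algorithm-run : ∀ {σ} → Input σ → Progress (σ liveness) (σ answer) (σ root 0) →
        Run algorithm σ (algorithmTime n m) λ τ → Progress (τ liveness) (τ answer) n
      algorithm-run {σ} inp pr = run-mono
        (run-while RoundI round-run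
          (+-mono-≤ (*-monoˡ-≤ (suc n) (liveCount≤n (σ liveness))) (m∸n≤m n (σ root 0))) (inp , pr , refl))
        λ { {τ} (_ , (inp′ , pr′ , _) , exit) → subst (Progress (τ liveness) (τ answer))
          (≤-antisym (Progress.i≤n pr′) (≤-trans (≤-reflexive (sym (InputAre.n≡ inp′))) (m∸n≡0⇒m≤n exit))) pr′ }

  -- Polynomial bounds for the running times

  private
    sucₚ : ∀ {f} → Polynomial f → Polynomial (λ n m → suc (f n m))
    sucₚ = poly-+ (poly-const 1)

  fillTime-polynomial : ∀ {f} → Polynomial f → Polynomial (λ n m → fillTime (f n m))
  fillTime-polynomial p = poly-+ (poly-const 3) (poly-* (sucₚ p) (poly-const 16))

  restartTime-polynomial : Polynomial (λ n _ → restartTime n)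
  restartTime-polynomial = poly-+ (fillTime-polynomial poly-fst) (poly-const 7)

  scanTime-polynomial : Polynomial (λ n _ → scanTime n)
  scanTime-polynomial = poly-+ (poly-const 20) (poly-+ (poly-+ (poly-const 18) (poly-+ (poly-const 6) visit′)) visit′)
    where
    augment′ : Polynomial (λ n _ → augmentTime n)
    augment′ = poly-+ (poly-* (sucₚ poly-fst) (poly-const 42)) (poly-+ (poly-const 6) restartTime-polynomial)
    visit′ : Polynomial (λ n _ → visitTime n)
    visit′ = poly-+ (poly-const 26) (poly-+ (poly-+ (poly-const 5) augment′) (poly-const 3))

  minCutTime-polynomial : Polynomial minCutTime
  minCutTime-polynomial =
    poly-+ (fillTime-polynomial poly-snd) (poly-+ (poly-const 3) (poly-+ restartTime-polynomial
      (poly-* (sucₚ (poly-+ (poly-* poly-snd (sucₚ digits)) digits)) (poly-+ (poly-const 6) scanTime-polynomial))))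
    where
    digits : Polynomial (λ n m → n * suc m + m)
    digits = poly-+ (poly-* poly-fst (sucₚ poly-snd)) poly-snd

  algorithmTime-polynomial : Polynomial algorithmTime
  algorithmTime-polynomial =
    poly-* (sucₚ (poly-+ (poly-* poly-fst (sucₚ poly-fst)) poly-fst))
      (poly-+ (poly-const 10) (poly-+ (poly-+ minCutTime-polynomial
        (poly-+ (poly-const (suc (cost small))) (poly-+ drop (poly-+ record′ (poly-const 6))))) (poly-const 6)))
    where
    drop : Polynomial (λ _ m → dropTime m)
    drop = poly-+ (poly-const 4) (poly-+ (fillTime-polynomial poly-snd) (poly-const 3))
    record′ : Polynomial (λ _ m → recordTime m)
    record′ = poly-+ (poly-const 3) (poly-* (sucₚ poly-snd) (poly-const 46))

-- Paths and cuts

member : ∀ {m} → Subset m → ℕ → Bool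
member []      _       = false
member (b ∷ F) zero    = b
member (b ∷ F) (suc i) = member F i

member-lookup : ∀ {m} (F : Subset m) e → member F (toℕ e) ≡ lookup F e
member-lookup (b ∷ F) Fin.zero    = refl
member-lookup (b ∷ F) (Fin.suc e) = member-lookup F e

∉⇒member : ∀ {m} {F : Subset m} {e} → e ∉ F → member F (toℕ e) ≡ false
∉⇒member {F = F} {e} e∉F with member F (toℕ e) in eq
... | false = refl
... | true  = contradiction (lookup⇒[]= e F (trans (sym (member-lookup F e)) eq)) e∉F

member⇒∉ : ∀ {m} {F : Subset m} {e} → member F (toℕ e) ≡ false → e ∉ F
member⇒∉ {F = F} {e} eq e∈F =
  true≢false (trans (sym (trans (member-lookup F e) ([]=⇒lookup e∈F))) eq)

∣∣-∑ : ∀ {m} (F : Subset m) → ∣ F ∣ ≡ ∑ m (indicator ∘ member F)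
∣∣-∑ []                = refl
∣∣-∑ {suc m} (true ∷ F)  = trans (cong suc (∣∣-∑ F)) (sym (∑-shift m (indicator ∘ member (true ∷ F))))
∣∣-∑ {suc m} (false ∷ F) = trans (∣∣-∑ F) (sym (∑-shift m (indicator ∘ member (false ∷ F))))

toArray-toℕ : ∀ {n} (f : Fin n → ℕ) i → toArray f (toℕ i) ≡ f i
toArray-toℕ {n} f i with toℕ i <? n
... | yes i<n = cong f (fromℕ<-toℕ i i<n)
... | no  i≮n = contradiction (toℕ<n i) i≮n

onFin : ∀ {m} (P : ℕ → Set) → (∀ i → P (toℕ {m} i)) → ∀ i → i < m → P i
onFin P p i i<m = subst P (toℕ-fromℕ< i<m) (p (fromℕ< i<m))

module GraphArrays (G : Graph) where
  open Graph G

  tails heads : ℕ → ℕ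
  tails = toArray λ e → toℕ (proj₁ (ends e))
  heads = toArray λ e → toℕ (proj₂ (ends e))

  tails-toℕ : ∀ e → tails (toℕ e) ≡ toℕ (proj₁ (ends e))
  tails-toℕ = toArray-toℕ λ e → toℕ (proj₁ (ends e))

  heads-toℕ : ∀ e → heads (toℕ e) ≡ toℕ (proj₂ (ends e))
  heads-toℕ = toArray-toℕ λ e → toℕ (proj₂ (ends e))

  tails<#V : ∀ e → e < #E → tails e < #V
  tails<#V = onFin _ λ e → ≤-trans (s≤s (≤-reflexive (tails-toℕ e))) (toℕ<n (proj₁ (ends e)))

  heads<#V : ∀ e → e < #E → heads e < #V
  heads<#V = onFin _ λ e → ≤-trans (s≤s (≤-reflexive (heads-toℕ e))) (toℕ<n (proj₂ (ends e)))

  start end : Bool → Fin #E → Fin #V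
  start true  e = proj₁ (ends e)
  start false e = proj₂ (ends e)
  end true  e = proj₂ (ends e)
  end false e = proj₁ (ends e)

  joins : ∀ d e → Joins G e (start d e) (end d e)
  joins true  e = inj₁ refl
  joins false e = inj₂ refl

  direction : ∀ {e u v} → Joins G e u v → Bool
  direction (inj₁ _) = true
  direction (inj₂ _) = false

  direction-joins : ∀ d e → direction (joins d e) ≡ d
  direction-joins true  e = refl
  direction-joins false e = refl

  start-joins : ∀ {e u v} (j : Joins G e u v) → start (direction j) e ≡ u
  start-joins (inj₁ eq) = cong proj₁ eq
  start-joins (inj₂ eq) = cong proj₂ eq

  end-joins : ∀ {e u v} (j : Joins G e u v) → end (direction j) e ≡ v
  end-joins (inj₁ eq) = cong proj₂ eq
  end-joins (inj₂ eq) = cong proj₁ eq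

  Along : (Fin #E → Bool → Set) → ∀ {u v} → Walk G u v → Set
  Along U stop         = ⊤
  Along U (step e j w) = U e (direction j) × Along U w

  along-map : ∀ {U U′ u v} (w : Walk G u v) → (∀ e d → e ∈ₗ edges G w → U e d → U′ e d) → Along U w → Along U′ w
  along-map stop         f _       = tt
  along-map (step e j w) f (x , a) = f e _ (here refl) x , along-map w (λ e′ d e′∈ → f e′ d (there e′∈)) a

  along-all : ∀ {U u v} {P : Fin #E → Set} (w : Walk G u v) → (∀ {e d} → U e d → P e) → Along U w → All P (edges G w)
  along-all stop         f _       = []
  along-all (step e j w) f (x , a) = f x ∷ along-all w f a

  source∈vertices : ∀ {u v} (w : Walk G u v) → u ∈ₗ vertices G w
  source∈vertices stop         = here refl
  source∈vertices (step _ _ _) = here refl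

  joins-same : ∀ {e x y u v} → Joins G e x y → Joins G e u v → x ≡ u ⊎ x ≡ v
  joins-same (inj₁ p) (inj₁ q) = inj₁ (cong proj₁ (trans (sym p) q))
  joins-same (inj₁ p) (inj₂ q) = inj₂ (cong proj₁ (trans (sym p) q))
  joins-same (inj₂ p) (inj₁ q) = inj₂ (cong proj₂ (trans (sym p) q))
  joins-same (inj₂ p) (inj₂ q) = inj₁ (cong proj₂ (trans (sym p) q))

  endpoint∈vertices : ∀ {e x y u v} (w : Walk G u v) → e ∈ₗ edges G w → Joins G e x y → x ∈ₗ vertices G w
  endpoint∈vertices (step e j w) (here refl) j′ with joins-same j′ j
  ... | inj₁ refl = here refl
  ... | inj₂ refl = there (source∈vertices w)
  endpoint∈vertices (step e j w) (there e∈w) j′ = there (endpoint∈vertices w e∈w j′)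

  -- Another occurrence of `e` would make its end `u` a vertex of `w`, against simplicity. So a push
  -- along the first edge cannot disturb the rest of the walk.
  first-edge-fresh : ∀ {e u v t} (j : Joins G e u v) (w : Walk G v t) → Unique (vertices G (step e j w)) → e ∉ₗ edges G w
  first-edge-fresh j w (u∉w ∷ _) e∈w = All.lookup u∉w (endpoint∈vertices w e∈w j) refl

  SimpleWalk : (Fin #E → Bool → Set) → Fin #V → Fin #V → Set
  SimpleWalk U s t = Σ (Walk G s t) λ w → Unique (vertices G w) × Along U w

  open Network #V #E tails heads using (unmarked; unmarked-set; unmarked≤n)

  -- A certificate that no walk exists: the marked vertices include `t` but not `s`, and no usable
  -- arc enters them from outside.
  record Unreachable (U : Fin #E → Bool → Set) (s t : Fin #V) : Set where
    field
      mark   : ℕ → ℕ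
      target : mark (toℕ t) ≢ 0
      source : mark (toℕ s) ≡ 0
      closed : ∀ e d → U e d → mark (toℕ (end d e)) ≢ 0 → mark (toℕ (start d e)) ≢ 0

  module _ {U : Fin #E → Bool → Set} (U? : ∀ e d → Dec (U e d)) (s t : Fin #V) where

    -- The search runs backwards from `t`, because `step` extends a walk at its front. As all
    -- vertices of a found walk are marked, an unmarked vertex put in front keeps it simple.
    Reaching : (ℕ → ℕ) → Fin #V → Set
    Reaching mark v = Σ (SimpleWalk U v t) λ w → All (λ x → mark (toℕ x) ≢ 0) (vertices G (proj₁ w))

    Enters : (ℕ → ℕ) → Fin #E → Bool → Set
    Enters mark e d = U e d × mark (toℕ (end d e)) ≢ 0 × mark (toℕ (start d e)) ≡ 0

    enters? : ∀ mark e d → Dec (Enters mark e d)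
    enters? mark e d = U? e d ×-dec (¬? (mark (toℕ (end d e)) ≟ 0) ×-dec (mark (toℕ (start d e)) ≟ 0))

    grow : ∀ fuel mark → unmarked mark ≤ fuel → mark (toℕ t) ≢ 0 →
      (∀ v → mark (toℕ v) ≢ 0 → Reaching mark v) → SimpleWalk U s t ⊎ Unreachable U s t
    grow fuel mark bound t∈M reach with any? (λ e → enters? mark e true ⊎-dec enters? mark e false)
    grow fuel mark bound t∈M reach | no none with mark (toℕ s) ≟ 0
    ... | no  s∈M = inj₁ (proj₁ (reach s s∈M))
    ... | yes s∉M = inj₂ (record { mark = mark ; target = t∈M ; source = s∉M ; closed = closed })
      where
      closed : ∀ e d → U e d → mark (toℕ (end d e)) ≢ 0 → mark (toℕ (start d e)) ≢ 0
      closed e true  u h s≡0 = none (e , inj₁ (u , h , s≡0))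
      closed e false u h s≡0 = none (e , inj₂ (u , h , s≡0))
    grow fuel mark bound t∈M reach | yes (e , enters) = extend (arc enters)
      where
      arc : Enters mark e true ⊎ Enters mark e false → Σ Bool (Enters mark e)
      arc (inj₁ x) = true , x
      arc (inj₂ x) = false , x
      extend : Σ Bool (Enters mark e) → SimpleWalk U s t ⊎ Unreachable U s t
      extend (d , u , h∈M , v∉M) = continue fuel bound
        where
        v = start d e
        mark′ = set mark (toℕ v) 1
        v≢ : ∀ {x} → mark (toℕ x) ≢ 0 → v ≢ x
        v≢ x∈M refl = x∈M v∉M
        keep : ∀ {x} → mark (toℕ x) ≢ 0 → mark′ (toℕ x) ≢ 0
        keep x∈M eq = x∈M (trans (sym (set-other mark 1 (v≢ x∈M ∘ toℕ-injective))) eq)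
        v∈M′ : mark′ (toℕ v) ≢ 0
        v∈M′ eq = 1+n≢0 (trans (sym (set-same mark (toℕ v) 1)) eq)
        reach′ : ∀ x → mark′ (toℕ x) ≢ 0 → Reaching mark′ x
        reach′ x x∈M′ with v Fin.≟ x
        ... | no v≢x with reach x (λ eq → x∈M′ (trans (set-other mark 1 (v≢x ∘ toℕ-injective)) eq))
        ...   | w , inM = w , All.map keep inM
        reach′ x x∈M′ | yes refl with reach (end d e) h∈M
        ... | (w , simple , along) , inM =
          ( step e (joins d e) w
          , All.map v≢ inM ∷ simple
          , subst (U e) (sym (direction-joins d e)) u , along)
          , v∈M′ ∷ All.map keep inM
        fewer : suc (unmarked mark′) ≡ unmarked mark
        fewer = unmarked-set mark (toℕ<n v) v∉M λ ()
        continue : ∀ fuel → unmarked mark ≤ fuel → SimpleWalk U s t ⊎ Unreachable U s t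
        continue zero    bound = contradiction (trans fewer (n≤0⇒n≡0 bound)) 1+n≢0
        continue (suc f) bound = grow f mark′ (≤-pred (≤-trans (≤-reflexive fewer) bound)) (keep t∈M) reach′

    search : SimpleWalk U s t ⊎ Unreachable U s t
    search = grow #V mark (unmarked≤n mark) (λ eq → 1+n≢0 (trans (sym (set-same _ (toℕ t) 1)) eq)) reach
      where
      mark = set (λ _ → 0) (toℕ t) 1
      reach : ∀ v → mark (toℕ v) ≢ 0 → Reaching mark v
      reach v v∈M with t Fin.≟ v
      ... | yes refl = (stop , [] ∷ [] , tt) , v∈M ∷ []
      ... | no  t≢v  = contradiction (set-other (λ _ → 0) 1 (t≢v ∘ toℕ-injective)) v∈M

-- Menger's theorem after the deletion of `F`

module Menger (G : Graph) (F : Subset (Graph.#E G)) where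
  open Graph G
  open GraphArrays G

  surviving : (ℕ → Bool) → ℕ → Bool
  surviving X e = (X (tails e) xor X (heads e)) ∧ not (member F e)

  -- The deleted edges are turned into loops, which cross no cut.
  heads∖F : ℕ → ℕ
  heads∖F e = if member F e then tails e else heads e

  open Network #V #E tails heads∖F

  crosses≡surviving : ∀ X e → crosses X e ≡ surviving X e
  crosses≡surviving X e = loop-xor (member F e) (tails e) (heads e)
    where
    loop-xor : ∀ b x y → X x xor X (if b then x else y) ≡ (X x xor X y) ∧ not b
    loop-xor true  x y = trans (Boolₚ.xor-same (X x)) (sym (Boolₚ.∧-zeroʳ _))
    loop-xor false x y = sym (Boolₚ.∧-identityʳ _)

  δ≡surviving : ∀ X → δ X ≡ ∑ #E (indicator ∘ surviving X)
  δ≡surviving X = ∑-cong #E λ e _ → cong indicator (crosses≡surviving X e)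

  heads∖F-toℕ : ∀ {e} → e ∉ F → heads∖F (toℕ e) ≡ toℕ (proj₂ (ends e))
  heads∖F-toℕ {e} e∉F = trans (cong (if_then tails (toℕ e) else heads (toℕ e)) (∉⇒member e∉F)) (heads-toℕ e)

  src-start : ∀ {e} → e ∉ F → ∀ d → src d (toℕ e) ≡ toℕ (start d e)
  src-start e∉F true  = tails-toℕ _
  src-start e∉F false = heads∖F-toℕ e∉F

  dst-end : ∀ {e} → e ∉ F → ∀ d → dst d (toℕ e) ≡ toℕ (end d e)
  dst-end e∉F true  = heads∖F-toℕ e∉F
  dst-end e∉F false = tails-toℕ _

  loop : ∀ {e} d → member F e ≡ true → src d e ≡ dst d e
  loop {e} true  e∈F = sym (cong (if_then tails e else heads e) e∈F)
  loop {e} false e∈F = cong (if_then tails e else heads e) e∈F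

  pushAll : (ℕ → ℕ) → ∀ {u v} → Walk G u v → ℕ → ℕ
  pushAll g stop         = g
  pushAll g (step e j w) = pushAll (push g (direction j) (toℕ e)) w

  pushAll-other : ∀ g {u v e} (w : Walk G u v) → e ∉ₗ edges G w → pushAll g w (toℕ e) ≡ g (toℕ e)
  pushAll-other g stop          _   = refl
  pushAll-other g (step e′ j w) e∉w =
    trans (pushAll-other _ w (e∉w ∘ there)) (set-other g _ λ eq → e∉w (here (sym (toℕ-injective eq))))

  -- `P` is `_≢ 0` for augmentation and `_≡ 2` for reading off paths: capacity 2 means that a unit
  -- flows against the arc, and a push along the arc cancels it.
  Open : (ℕ → Set) → (ℕ → ℕ) → Fin #E → Bool → Set
  Open P g e d = e ∉ F × P (cap g d (toℕ e))

  open-after-push : ∀ {P g u v t e} (j : Joins G e u v) (w : Walk G v t) → Unique (vertices G (step e j w)) →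
    Along (Open P g) w → Along (Open P (push g (direction j) (toℕ e))) w
  open-after-push {P} {g} j w simple = along-map w λ e′ d e′∈w → λ (e′∉F , p) →
    e′∉F , subst P (cong (capAt d) (sym (set-other g _ λ eq →
      first-edge-fresh j w simple (subst (_∈ₗ edges G w) (sym (toℕ-injective eq)) e′∈w)))) p

  -- The equations of `push-ρ` telescope, the contributions of inner vertices cancelling; simplicity
  -- keeps the remaining arcs open after each push.
  pushAll-flow : ∀ {g u v} (w : Walk G u v) → Unique (vertices G w) → Along (Open (_≢ 0) g) w → Bounded g →
    Bounded (pushAll g w) × (∀ X → ρ (pushAll g w) X + indicator (X (toℕ u)) ≡ ρ g X + indicator (X (toℕ v)))
  pushAll-flow stop _ _ bdd = bdd , λ _ → refl
  pushAll-flow {g} {u} {t} (step {v = v} e j w) simple@(_ ∷ simple′) ((e∉F , c) , along) bdd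
    with pushAll-flow w simple′ (open-after-push {_≢ 0} {g} j w simple along) (push-bounded {g} {direction j} bdd (toℕ<n e) c)
  ... | bdd′ , ρ′ = bdd′ , λ X → +-cancelʳ-≡ (indicator (X (toℕ v))) _ _ (begin
    r X + x X u + x X v           ≡⟨ xy∙z≈xz∙y (r X) (x X u) (x X v) ⟩
    r X + x X v + x X u           ≡⟨ cong (_+ x X u) (ρ′ X) ⟩
    ρ g′ X + x X t + x X u        ≡⟨ xy∙z≈xz∙y (ρ g′ X) (x X t) (x X u) ⟩
    ρ g′ X + x X u + x X t        ≡⟨ cong (_+ x X t) (first X) ⟩
    ρ g X + x X v + x X t         ≡⟨ xy∙z≈xz∙y (ρ g X) (x X v) (x X t) ⟩
    ρ g X + x X t + x X v         ∎)
    where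
    open ≡-Reasoning
    g′ = push g (direction j) (toℕ e)
    r = ρ (pushAll g′ w)
    x : (ℕ → Bool) → Fin #V → ℕ
    x X y = indicator (X (toℕ y))
    first : ∀ X → ρ g′ X + x X u ≡ ρ g X + x X v
    first X = subst₂ (λ a b → ρ g′ X + indicator (X a) ≡ ρ g X + indicator (X b))
      (trans (src-start e∉F (direction j)) (cong toℕ (start-joins j)))
      (trans (dst-end e∉F (direction j)) (cong toℕ (end-joins j)))
      (push-ρ {g} {direction j} X bdd (toℕ<n e) c)

  capAt-bump≡1 : ∀ d x → x ≤ 2 → capAt d x ≡ 2 → bump d x ≡ 1
  capAt-bump≡1 true  zero          _ _ = refl
  capAt-bump≡1 true  (suc zero)    _ ()
  capAt-bump≡1 true  (suc (suc x)) _ eq = contradiction (trans (sym (0∸n≡0 x)) eq) 0≢1+n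
  capAt-bump≡1 false .2            _ refl = refl

  pushAll-cancels : ∀ {g u v e} (w : Walk G u v) → Unique (vertices G w) → Along (Open (_≡ 2) g) w → Bounded g →
    e ∈ₗ edges G w → pushAll g w (toℕ e) ≡ 1
  pushAll-cancels {g} (step e j w) simple ((_ , c) , _) bdd (here refl) =
    trans (pushAll-other _ w (first-edge-fresh j w simple))
      (trans (set-same g (toℕ e) _) (capAt-bump≡1 (direction j) (g (toℕ e)) (bdd (toℕ e) (toℕ<n e)) c))
  pushAll-cancels {g} (step e j w) simple@(_ ∷ simple′) ((_ , c) , along) bdd (there e∈w) =
    pushAll-cancels w simple′ (open-after-push {_≡ 2} {g} j w simple along)
      (push-bounded {g} {direction j} bdd (toℕ<n e) (λ c≡0 → 0≢1+n (trans (sym c≡0) c))) e∈w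

  module _ (a b : Fin #V) where

    Separates : (ℕ → Bool) → Set
    Separates X = X (toℕ a) ≡ true × X (toℕ b) ≡ false

    open? : ∀ {P : ℕ → Set} (P? : ∀ x → Dec (P x)) g e d → Dec (Open P g e d)
    open? P? g e d with member F (toℕ e) in eq
    ... | true  = no λ (e∉F , _) → true≢false (trans (sym eq) (∉⇒member e∉F))
    ... | false with P? (cap g d (toℕ e))
    ...   | yes p = yes (member⇒∉ eq , p)
    ...   | no ¬p = no (¬p ∘ proj₂)

    -- One unit is added at a time. When no residual walk leads from `a` to `b`, the vertices that
    -- cannot reach `b` form a saturated set, whose cut has exactly the value `j` of the flow and so
    -- fewer than `suc j` edges.
    flow-or-cut : ∀ j → (∃[ g ] Flow Separates g j) ⊎ (∃[ X ] Separates X × δ X < j)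
    flow-or-cut zero = inj₁ ((λ _ → 1) , zero-flow λ _ _ → refl)
    flow-or-cut (suc j) with flow-or-cut j
    ... | inj₂ (X , sep , δ<j) = inj₂ (X , sep , m<n⇒m<1+n δ<j)
    ... | inj₁ (g , fl) with search (open? (λ x → ¬? (x ≟ 0)) g) a b
    ...   | inj₁ (w , simple , along) with pushAll-flow w simple along (Flow.bounded fl)
    ...     | bdd , ρ′ = inj₁ (pushAll g w , record { bounded = bdd ; balance = balance′ })
      where
      balance′ : ∀ X → Separates X → ρ (pushAll g w) X + suc j ≡ δ X
      balance′ X sep@(a∈X , b∉X) = begin
        ρ (pushAll g w) X + suc j    ≡⟨ sym (+-assoc _ 1 j) ⟩
        ρ (pushAll g w) X + 1 + j
          ≡⟨ cong (_+ j) (subst₂ (λ x y → ρ (pushAll g w) X + indicator x ≡ ρ g X + indicator y) a∈X b∉X (ρ′ X)) ⟩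
        ρ g X + 0 + j                ≡⟨ cong (_+ j) (+-identityʳ _) ⟩
        ρ g X + j                    ≡⟨ Flow.balance fl X sep ⟩
        δ X                          ∎
        where open ≡-Reasoning
    flow-or-cut (suc j) | inj₁ (g , fl) | inj₂ un =
      inj₂ (X , MinCut.separates mc , s≤s (≤-reflexive (MinCut.δ≡value mc)))
      where
      open Unreachable un
      X = not ∘ nonzero ∘ mark
      blocked : ∀ d e → X (src d (toℕ e)) ≡ true → X (dst d (toℕ e)) ≡ false → cap g d (toℕ e) ≡ 0
      blocked d e s∈X t∉X with member F (toℕ e) in eq
      ... | true = contradiction (trans (sym s∈X) (trans (cong X (loop d eq)) t∉X)) true≢false
      ... | false with cap g d (toℕ e) ≟ 0
      ...   | yes c≡0 = c≡0
      ...   | no  c≢0 = contradiction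
        (not-nonzero-true (subst (λ v → X v ≡ true) (src-start (member⇒∉ eq) d) s∈X))
        (closed e d (member⇒∉ eq , c≢0) (not-nonzero-false (subst (λ v → X v ≡ false) (dst-end (member⇒∉ eq) d) t∉X)))
        where
        not-nonzero-true : ∀ {x} → not (nonzero x) ≡ true → x ≡ 0
        not-nonzero-true {zero} _ = refl
        not-nonzero-false : ∀ {x} → not (nonzero x) ≡ false → x ≢ 0
        not-nonzero-false {suc _} _ ()
      mc : MinCut Separates j X
      mc = saturated⇒MinCut X fl
        (cong (not ∘ nonzero) source , cong not (nonzero-true target))
        (onFin _ λ e d → blocked d e)

  -- Paths are read off against the flow, hence from `b` to `a`. Cancelling the unit on one path
  -- leaves its edges without flow, and the later paths use only edges that carry flow, so they are
  -- disjoint from it.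
  decompose : ∀ a b j g → Flow (Separates a b) g j →
    Σ (HasEdgeDisjointPaths G F b a j) λ (P , _) → ∀ i {e} → e ∈ₗ pathEdges G (P i) → g (toℕ e) ≢ 1
  decompose a b zero    g fl = ((λ ()) , λ ()) , λ ()
  decompose a b (suc j) g fl with search (open? a b (_≟ 2) g) b a
  ... | inj₁ (w , simple , along) with pushAll-flow w simple
        (along-map w (λ _ _ _ (e∉F , c≡2) → e∉F , λ c≡0 → 0≢1+n (trans (sym c≡0) c≡2)) along) (Flow.bounded fl)
  ...   | bdd , ρ′ with decompose a b j (pushAll g w) (record { bounded = bdd ; balance = balance′ })
    where
    balance′ : ∀ X → Separates a b X → ρ (pushAll g w) X + j ≡ δ X
    balance′ X sep@(a∈X , b∉X) = begin
      ρ (pushAll g w) X + j        ≡⟨ cong (_+ j) (sym (+-identityʳ _)) ⟩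
      ρ (pushAll g w) X + 0 + j
        ≡⟨ cong (_+ j) (subst₂ (λ x y → ρ (pushAll g w) X + indicator x ≡ ρ g X + indicator y) b∉X a∈X (ρ′ X)) ⟩
      ρ g X + 1 + j                ≡⟨ +-assoc _ 1 j ⟩
      ρ g X + suc j                ≡⟨ Flow.balance fl X sep ⟩
      δ X                          ∎
      where open ≡-Reasoning
  ...     | (P , disjoint) , carried = (P′ , disjoint′) , carried′
    where
    P′ : Fin (suc j) → PathAvoiding G F b a
    P′ Fin.zero    = record { walk = w ; simple = simple ; avoids = along-all w proj₁ along }
    P′ (Fin.suc i) = P i
    off-w : ∀ i {e} → e ∈ₗ pathEdges G (P i) → e ∉ₗ edges G w
    off-w i e∈P e∈w = carried i e∈P (pushAll-cancels w simple along (Flow.bounded fl) e∈w)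
    disjoint′ : ∀ i i′ → i ≢ i′ → ∀ {e} → ¬ (e ∈ₗ pathEdges G (P′ i) × e ∈ₗ pathEdges G (P′ i′))
    disjoint′ Fin.zero    Fin.zero     i≢i′ _ = i≢i′ refl
    disjoint′ Fin.zero    (Fin.suc i′) _ (e∈w , e∈P) = off-w i′ e∈P e∈w
    disjoint′ (Fin.suc i) Fin.zero     _ (e∈P , e∈w) = off-w i e∈P e∈w
    disjoint′ (Fin.suc i) (Fin.suc i′) i≢i′ = disjoint i i′ (i≢i′ ∘ cong Fin.suc)
    capAt≡2⇒≢1 : ∀ d {x} → capAt d x ≡ 2 → x ≢ 1
    capAt≡2⇒≢1 true  () refl
    capAt≡2⇒≢1 false () refl
    carried′ : ∀ i {e} → e ∈ₗ pathEdges G (P′ i) → g (toℕ e) ≢ 1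
    carried′ Fin.zero    = All.lookup (along-all w (λ {_} {d} (_ , c) → capAt≡2⇒≢1 d c) along)
    carried′ (Fin.suc i) e∈P g≡1 = carried i e∈P (trans (pushAll-other g w (off-w i e∈P)) g≡1)
  -- Without such a path, no flow leaves the set `X` of vertices that reach `a` against the flow.
  -- Each crossing edge then has residual capacity at least 1 outwards, so `δ X ≤ ρ g X`, which
  -- contradicts the positive value.
  decompose a b (suc j) g fl | inj₂ un = contradiction
    (≤-trans (≤-reflexive (Flow.balance fl X (nonzero-true target , cong nonzero source)))
             (∑-mono #E (onFin _ λ e → free (X (tails (toℕ e))) _ (Flow.bounded fl _ (toℕ<n e)) (unused false e) (unused true e))))
    (m+1+n≰m (ρ g X))
    where
    open Unreachable un
    X = nonzero ∘ mark
    unused : ∀ d e → X (dst d (toℕ e)) ≡ true → X (src d (toℕ e)) ≡ false → cap g d (toℕ e) ≢ 2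
    unused d e t∈X s∉X c≡2 with member F (toℕ e) in eq
    ... | true  = contradiction (trans (sym t∈X) (trans (cong X (sym (loop d eq))) s∉X)) true≢false
    ... | false = closed e d (member⇒∉ eq , c≡2)
      (nonzero⇒≢0 (subst (λ v → X v ≡ true) (dst-end (member⇒∉ eq) d) t∈X))
      (nonzero-false (subst (λ v → X v ≡ false) (src-start (member⇒∉ eq) d) s∉X))
    free : ∀ x y {v} → v ≤ 2 → (x ≡ true → y ≡ false → v ≢ 2) → (y ≡ true → x ≡ false → 2 ∸ v ≢ 2) →
      indicator (x xor y) ≤ leaveAt x y v
    free true  true  _   _ _ = z≤n
    free false false _   _ _ = z≤n
    free true  false v≤2 f _ = m<n⇒0<n∸m (≤∧≢⇒< v≤2 (f refl refl))
    free false true {zero}  _ _ h = contradiction refl (h refl refl)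
    free false true {suc v} _ _ _ = s≤s z≤n

  menger : ∀ s t j → HasEdgeDisjointPaths G F s t j ⊎
    (∃[ X ] X (toℕ s) ≢ X (toℕ t) × ∑ #E (indicator ∘ surviving X) < j)
  -- The ends are exchanged because the paths run against the flow.
  menger s t j with flow-or-cut t s j
  ... | inj₁ (g , fl) = inj₁ (proj₁ (decompose t s j g fl))
  ... | inj₂ (X , (t∈X , s∉X) , δ<j) = inj₂ (X
    , (λ eq → true≢false (trans (sym t∈X) (trans (sym eq) s∉X)))
    , subst (_< j) (δ≡surviving X) δ<j)

  crossing-edge : ∀ X {s t} (w : Walk G s t) → All (_∉ F) (edges G w) → X (toℕ s) ≢ X (toℕ t) →
    ∃[ e ] e ∈ₗ edges G w × surviving X (toℕ e) ≡ true
  crossing-edge X stop _ X≢ = contradiction refl X≢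
  crossing-edge X {s} (step {v = v} e j w) (e∉F ∷ avoids) X≢ with X (toℕ s) Boolₚ.≟ X (toℕ v)
  ... | yes same with crossing-edge X w avoids (X≢ ∘ trans same)
  ...   | e′ , e′∈w , cr = e′ , there e′∈w , cr
  crossing-edge X {s} (step {v = v} e j w) (e∉F ∷ avoids) X≢ | no differ = e , here refl ,
    trans (cong₂ (λ x y → x ∧ not y) (joined j) (∉⇒member e∉F)) refl
    where
    xor-≢ : ∀ {x y} → x ≢ y → x xor y ≡ true
    xor-≢ {true}  {true}  x≢y = contradiction refl x≢y
    xor-≢ {true}  {false} x≢y = refl
    xor-≢ {false} {true}  x≢y = refl
    xor-≢ {false} {false} x≢y = contradiction refl x≢y
    at-ends : X (tails (toℕ e)) xor X (heads (toℕ e)) ≡ X (toℕ (proj₁ (ends e))) xor X (toℕ (proj₂ (ends e)))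
    at-ends = cong₂ (λ a b → X a xor X b) (tails-toℕ e) (heads-toℕ e)
    joined : Joins G e s v → X (tails (toℕ e)) xor X (heads (toℕ e)) ≡ true
    joined (inj₁ eq) = trans at-ends (trans (cong (λ (a , b) → X (toℕ a) xor X (toℕ b)) eq) (xor-≢ differ))
    joined (inj₂ eq) = trans at-ends (trans (cong (λ (a , b) → X (toℕ a) xor X (toℕ b)) eq) (xor-≢ (differ ∘ sym)))

  -- Every path has a surviving edge across the cut, and disjointness makes the chosen edges
  -- distinct.
  paths≤cut : ∀ X {s t} j → HasEdgeDisjointPaths G F s t j → X (toℕ s) ≢ X (toℕ t) →
    j ≤ ∑ #E (indicator ∘ surviving X)
  paths≤cut X {s} {t} j (P , disjoint) X≢ = injection⇒≤∑ j #E (toℕ ∘ proj₁ ∘ crossing) _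
    (toℕ<n ∘ proj₁ ∘ crossing)
    (λ i eq → 1+n≢0 (trans (cong indicator (sym (proj₂ (proj₂ (crossing i))))) eq))
    λ i i′ eq → case i Fin.≟ i′ of λ where
      (yes i≡i′) → i≡i′
      (no  i≢i′) → contradiction
        (proj₁ (proj₂ (crossing i)) , subst (_∈ₗ pathEdges G (P i′)) (sym (toℕ-injective eq)) (proj₁ (proj₂ (crossing i′))))
        (disjoint i i′ i≢i′)
    where
    crossing : ∀ i → ∃[ e ] e ∈ₗ pathEdges G (P i) × surviving X (toℕ e) ≡ true
    crossing i = crossing-edge X (PathAvoiding.walk (P i)) (PathAvoiding.avoids (P i)) X≢

-- Lower bound on the optimum

module Partition (n m : ℕ) (A B : ℕ → ℕ) (live : ℕ → ℕ) (kept : ℕ → Bool) (c : ℕ)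
  (separable : ∀ s t → s < n → t < n → live s ≢ 0 → live t ≢ 0 → s ≢ t →
    Σ[ X ∈ (ℕ → Bool) ] X s ≢ X t × ∑ m (λ e → indicator ((X (A e) xor X (B e)) ∧ kept e)) ≤ c) where

  open Network n m A B

  Label : Set
  Label = List Bool

  same : Label → Label → Bool
  same x y = does (≡-dec Boolₚ._≟_ x y)

  same-true : ∀ {x y} → same x y ≡ true → x ≡ y
  same-true {x} {y} eq with ≡-dec Boolₚ._≟_ x y
  ... | yes x≡y = x≡y

  same-refl : ∀ x → same x x ≡ true
  same-refl x with ≡-dec Boolₚ._≟_ x x
  ... | yes _   = refl
  ... | no  x≢x = contradiction refl x≢x

  same-false : ∀ {x y} → x ≢ y → same x y ≡ false
  same-false {x} {y} x≢y with ≡-dec Boolₚ._≟_ x y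
  ... | yes x≡y = contradiction x≡y x≢y
  ... | no  _   = refl

  differs : (ℕ → Label) → ℕ → Bool
  differs L e = not (same (L (A e)) (L (B e)))

  liveBelow : ℕ → ℕ
  liveBelow i = ∑ i (indicator ∘ nonzero ∘ live)

  -- L v lists the sides of v in the cuts chosen so far; a new cut is only needed
  -- when the next terminal has the label of an earlier one.
  record Labelling (i : ℕ) : Set where
    field
      L      : ℕ → Label
      inject : ∀ s t → s < i → t < i → live s ≢ 0 → live t ≢ 0 → L s ≡ L t → s ≡ t
      total   : ∑ m (λ e → indicator (differs L e ∧ kept e)) ≤ liveBelow i * c

  -- Two extended labels differ only if the old labels differ or the new cut separates the ends, so
  -- a refinement adds at most the kept edges of the new cut.
  cons-differs : ∀ x y b b′ k →
    indicator (not (same (b ∷ x) (b′ ∷ y)) ∧ k) ≤ indicator (not (same x y) ∧ k) + indicator ((b xor b′) ∧ k)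
  cons-differs x y b b′ false = ≤-trans (≤-reflexive (cong indicator (Boolₚ.∧-zeroʳ (not (same (b ∷ x) (b′ ∷ y)))))) z≤n
  cons-differs x y b b′ true with ≡-dec Boolₚ._≟_ x y
  ... | no x≢y = ≤-trans (indicator≤1 _) (m≤m+n 1 _)
  ... | yes refl with b | b′
  ...   | true  | true  = z≤n
  ...   | true  | false = indicator≤1 _
  ...   | false | true  = indicator≤1 _
  ...   | false | false = z≤n

  labelling : ∀ i → i ≤ n → Labelling i
  labelling zero    _   = record { L = λ _ → [] ; inject = λ _ _ () ; total = ≤-reflexive (∑-zero m λ e _ → refl) }
  labelling (suc i) i<n with labelling i (<⇒≤ i<n) | live i ≟ 0
  ... | lab | yes dead = record { L = L ; inject = inject′ ; total = ≤-trans total (*-monoˡ-≤ c (m≤m+n (liveBelow i) _)) }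
    where
    open Labelling lab
    below : ∀ {s} → s < suc i → live s ≢ 0 → s < i
    below s<1+i live-s = ≤∧≢⇒< (≤-pred s<1+i) λ { refl → live-s dead }
    inject′ : ∀ s t → s < suc i → t < suc i → live s ≢ 0 → live t ≢ 0 → L s ≡ L t → s ≡ t
    inject′ s t s< t< ls lt = inject s t (below s< ls) (below t< lt) ls lt
  ... | lab | no alive with anyUpTo? (λ t → ¬? (live t ≟ 0) ×-dec ≡-dec Boolₚ._≟_ (Labelling.L lab t) (Labelling.L lab i)) i
  ...   | no none = record { L = L ; inject = inject′ ; total = ≤-trans total (*-monoˡ-≤ c (m≤m+n (liveBelow i) _)) }
    where
    open Labelling lab
    inject′ : ∀ s t → s < suc i → t < suc i → live s ≢ 0 → live t ≢ 0 → L s ≡ L t → s ≡ t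
    inject′ s t s< t< ls lt eq with s ≟ i | t ≟ i
    ... | yes refl | yes refl = refl
    ... | yes refl | no  t≢i  = contradiction (t , ≤∧≢⇒< (≤-pred t<) t≢i , lt , sym eq) none
    ... | no  s≢i  | yes refl = contradiction (s , ≤∧≢⇒< (≤-pred s<) s≢i , ls , eq) none
    ... | no  s≢i  | no  t≢i  = inject s t (≤∧≢⇒< (≤-pred s<) s≢i) (≤∧≢⇒< (≤-pred t<) t≢i) ls lt eq
  ...   | yes (t₀ , t₀<i , lt₀ , Lt₀≡Li) with separable i t₀ i<n (<-trans t₀<i i<n) alive lt₀ (>⇒≢ t₀<i)
  ...     | X , Xi≢Xt₀ , X≤c = record { L = L′ ; inject = inject′ ; total = size′ }
    where
    open Labelling lab
    L′ : ℕ → Label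
    L′ v = X v ∷ L v
    -- By injectivity `t₀` is the only earlier live vertex with the label of `i`, so one cut between
    -- `i` and `t₀` is enough to separate `i` from all earlier ones.
    clash : ∀ {s} → s < i → live s ≢ 0 → L′ s ≢ L′ i
    clash {s} s<i ls eq with inject s t₀ s<i t₀<i ls lt₀ (trans (∷-injectiveʳ eq) (sym Lt₀≡Li))
    ... | refl = Xi≢Xt₀ (sym (∷-injectiveˡ eq))
    inject′ : ∀ s t → s < suc i → t < suc i → live s ≢ 0 → live t ≢ 0 → L′ s ≡ L′ t → s ≡ t
    inject′ s t s< t< ls lt eq with s ≟ i | t ≟ i
    ... | yes refl | yes refl = refl
    ... | yes refl | no  t≢i  = contradiction (sym eq) (clash (≤∧≢⇒< (≤-pred t<) t≢i) lt)
    ... | no  s≢i  | yes refl = contradiction eq (clash (≤∧≢⇒< (≤-pred s<) s≢i) ls)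
    ... | no  s≢i  | no  t≢i  = inject s t (≤∧≢⇒< (≤-pred s<) s≢i) (≤∧≢⇒< (≤-pred t<) t≢i) ls lt (∷-injectiveʳ eq)
    size′ : ∑ m (λ e → indicator (differs L′ e ∧ kept e)) ≤ liveBelow (suc i) * c
    size′ = begin
      ∑ m (λ e → indicator (differs L′ e ∧ kept e))
        ≤⟨ ∑-mono m (λ e _ → cons-differs (L (A e)) (L (B e)) (X (A e)) (X (B e)) (kept e)) ⟩
      ∑ m (λ e → indicator (differs L e ∧ kept e) + indicator ((X (A e) xor X (B e)) ∧ kept e))
        ≡⟨ ∑-+ m _ _ ⟩
      ∑ m (λ e → indicator (differs L e ∧ kept e)) + ∑ m (λ e → indicator ((X (A e) xor X (B e)) ∧ kept e))
        ≤⟨ +-mono-≤ total X≤c ⟩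
      liveBelow i * c + c
        ≡⟨ +-comm _ c ⟩
      suc (liveBelow i) * c
        ≡⟨ cong (_* c) (trans (+-comm 1 _) (cong (λ b → liveBelow i + indicator b) (sym (nonzero-true alive)))) ⟩
      liveBelow (suc i) * c ∎
      where open ≤-Reasoning

  module _ (d : ℕ → ℕ)
    (minimal : ∀ t → t < n → live t ≢ 0 → ∀ X → Isolates n live t X → d t ≤ δ X) where

    open Labelling (labelling n ≤-refl)

    class : ℕ → ℕ → Bool
    class t v = same (L v) (L t)

    class-isolates : ∀ t → t < n → live t ≢ 0 → Isolates n live t (class t)
    class-isolates t t<n lt = record
      { inside  = same-refl (L t)
      ; outside = λ v v<n lv v≢t → same-false (v≢t ∘ inject v t v<n t<n lv lt)
      }

    leaves : ℕ → ℕ → ℕ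
    leaves t e = if nonzero (live t) then indicator (crosses (class t) e) else 0

    hits : Label → ℕ → Bool
    hits x t = nonzero (live t) ∧ same x (L t)

    hits≤1 : ∀ x → ∑ n (indicator ∘ hits x) ≤ 1
    hits≤1 x = ∑-indicator≤1 n (hits x) λ s t s<n t<n hs ht →
      inject s t s<n t<n (live-if (nonzero (live s)) refl hs) (live-if (nonzero (live t)) refl ht)
        (trans (sym (same-if (nonzero (live s)) hs)) (same-if (nonzero (live t)) ht))
      where
      live-if : ∀ b {t} → nonzero (live t) ≡ b → b ∧ same x (L t) ≡ true → live t ≢ 0
      live-if true eq _ = nonzero⇒≢0 eq
      same-if : ∀ b {y} → b ∧ same x y ≡ true → x ≡ y
      same-if true = same-true

    -- An edge within a class leaves none of them; any other edge leaves at most the classes of its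
    -- two ends, and each of these belongs to at most one live vertex. This is the source of the
    -- factor 2.
    leaves-total : ∀ e → ∑ n (λ t → leaves t e) ≤ 2 * indicator (differs L e)
    leaves-total e with ≡-dec Boolₚ._≟_ (L (A e)) (L (B e))
    ... | yes eq = ≤-reflexive (∑-zero n λ t _ → stays t)
      where
      stays : ∀ t → leaves t e ≡ 0
      stays t with nonzero (live t)
      ... | false = refl
      ... | true  = cong indicator (trans (cong (λ x → same x (L t) xor same (L (B e)) (L t)) eq) (Boolₚ.xor-same (same (L (B e)) (L t))))
    ... | no _ = begin
      ∑ n (λ t → leaves t e)
        ≤⟨ ∑-mono n (λ t _ → split (nonzero (live t)) (same (L (A e)) (L t)) (same (L (B e)) (L t))) ⟩
      ∑ n (λ t → indicator (hits (L (A e)) t) + indicator (hits (L (B e)) t)) ≡⟨ ∑-+ n _ _ ⟩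
      ∑ n (indicator ∘ hits (L (A e))) + ∑ n (indicator ∘ hits (L (B e)))
        ≤⟨ +-mono-≤ (hits≤1 (L (A e))) (hits≤1 (L (B e))) ⟩
      2                                                             ∎
      where
      open ≤-Reasoning
      split : ∀ a x y → (if a then indicator (x xor y) else 0) ≤ indicator (a ∧ x) + indicator (a ∧ y)
      split false x     y     = z≤n
      split true  true  true  = z≤n
      split true  true  false = ≤-refl
      split true  false true  = ≤-refl
      split true  false false = z≤n

    -- Double counting of the pairs of a live vertex and a boundary edge of its class; the edges
    -- between classes are then split into deleted and kept ones.
    isolating-total : ∑ n (λ t → if nonzero (live t) then d t else 0)
                      ≤ 2 * (∑ m (indicator ∘ not ∘ kept) + liveBelow n * c)
    isolating-total = begin
      ∑ n (λ t → if nonzero (live t) then d t else 0)   ≤⟨ ∑-mono n (λ t t<n → through t t<n) ⟩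
      ∑ n (λ t → ∑ m (leaves t))                        ≡⟨ ∑-swap n m leaves ⟩
      ∑ m (λ e → ∑ n (λ t → leaves t e))
        ≤⟨ ∑-mono m (λ e _ → ≤-trans (leaves-total e) (*-monoʳ-≤ 2 (deleted-or-kept (differs L e) (kept e)))) ⟩
      ∑ m (λ e → 2 * (indicator (not (kept e)) + indicator (differs L e ∧ kept e))) ≡⟨ double m _ ⟩
      2 * ∑ m (λ e → indicator (not (kept e)) + indicator (differs L e ∧ kept e)) ≡⟨ cong (2 *_) (∑-+ m _ _) ⟩
      2 * (∑ m (indicator ∘ not ∘ kept) + ∑ m (λ e → indicator (differs L e ∧ kept e)))
        ≤⟨ *-monoʳ-≤ 2 (+-monoʳ-≤ (∑ m (indicator ∘ not ∘ kept)) total) ⟩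
      2 * (∑ m (indicator ∘ not ∘ kept) + liveBelow n * c) ∎
      where
      open ≤-Reasoning
      through : ∀ t → t < n → (if nonzero (live t) then d t else 0) ≤ ∑ m (leaves t)
      through t t<n with live t ≟ 0
      ... | yes dead = ≤-trans (≤-reflexive (cong (λ x → if nonzero x then d t else 0) dead)) z≤n
      ... | no  lt   = ≤-trans (≤-reflexive (cong (if_then d t else 0) (nonzero-true lt)))
        (≤-trans (minimal t t<n lt (class t) (class-isolates t t<n lt))
          (≤-reflexive (∑-cong m λ e _ → cong (if_then indicator (crosses (class t) e) else 0) (sym (nonzero-true lt)))))
      deleted-or-kept : ∀ x k → indicator x ≤ indicator (not k) + indicator (x ∧ k)
      deleted-or-kept x     false = ≤-trans (indicator≤1 x) (m≤m+n 1 _)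
      deleted-or-kept true  true  = ≤-refl
      deleted-or-kept false true  = z≤n
      double : ∀ m f → ∑ m (λ e → 2 * f e) ≡ 2 * ∑ m f
      double zero    f = refl
      double (suc m) f = trans (cong (_+ 2 * f m) (double m f)) (sym (*-distribˡ-+ 2 (∑ m f) (f m)))

-- Ordered fields

module FieldProperties {c ℓ₁ ℓ₂} (K : OrderedField c ℓ₁ ℓ₂) where
  open OrderedField K renaming (+-monoˡ-≤ to +ᴷ-monoˡ-≤)
  module R = CommutativeRing commutativeRing
  open R using () renaming (refl to ≈-refl; sym to ≈-sym; trans to ≈-trans)
  module ≤ᴷ = IsDecTotalOrder isDecTotalOrder
  open RingProperties R.ring using (-‿distribʳ-*; -‿distribˡ-*; -‿involutive)
  open Mult R.semiring using (×-homo-+; ×1-homo-*)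
  open NaturalSolver R.commutativeSemiring using (solve; _:=_; _:+_; _:*_)

  ≤-respects : ∀ {x x′ y y′} → x ≈ x′ → y ≈ y′ → x ≤ᴷ y → x′ ≤ᴷ y′
  ≤-respects x≈ y≈ x≤y = ≤ᴷ.trans (≤ᴷ.reflexive (≈-sym x≈)) (≤ᴷ.trans x≤y (≤ᴷ.reflexive y≈))

  +ᴷ-mono-≤ : ∀ {x y u v} → x ≤ᴷ y → u ≤ᴷ v → (x +ᴷ u) ≤ᴷ (y +ᴷ v)
  +ᴷ-mono-≤ {x} {y} {u} {v} x≤y u≤v =
    ≤ᴷ.trans (+ᴷ-monoˡ-≤ u x≤y) (≤-respects (R.+-comm u y) (R.+-comm v y) (+ᴷ-monoˡ-≤ y u≤v))

  x≤y⇒0≤y-x : ∀ {x y} → x ≤ᴷ y → 0# ≤ᴷ (y +ᴷ (- x))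
  x≤y⇒0≤y-x {x} x≤y = ≤-respects (R.-‿inverseʳ x) ≈-refl (+ᴷ-monoˡ-≤ (- x) x≤y)

  0≤y-x⇒x≤y : ∀ {x y} → 0# ≤ᴷ (y +ᴷ (- x)) → x ≤ᴷ y
  0≤y-x⇒x≤y {x} {y} 0≤ = ≤-respects (R.+-identityˡ x)
    (≈-trans (R.+-assoc y (- x) x) (≈-trans (R.+-congˡ (R.-‿inverseˡ x)) (R.+-identityʳ y))) (+ᴷ-monoˡ-≤ x 0≤)

  0≤-x : ∀ {x} → x ≤ᴷ 0# → 0# ≤ᴷ (- x)
  0≤-x {x} x≤0 = ≤-respects ≈-refl (R.+-identityˡ (- x)) (x≤y⇒0≤y-x x≤0)

  -- Otherwise -1 would be nonnegative, and so would its square, which is 1.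
  0≤1 : 0# ≤ᴷ 1#
  0≤1 with ≤ᴷ.total 0# 1#
  ... | inj₁ 0≤1 = 0≤1
  ... | inj₂ 1≤0 = ≤-respects ≈-refl
    (≈-trans (≈-sym (-‿distribˡ-* 1# (- 1#))) (≈-trans (R.-‿cong (R.*-identityˡ (- 1#))) (-‿involutive 1#)))
    (*-nonneg (0≤-x 1≤0) (0≤-x 1≤0))

  *ᴷ-monoʳ-≤ : ∀ {x y} z → 0# ≤ᴷ z → x ≤ᴷ y → (z *ᴷ x) ≤ᴷ (z *ᴷ y)
  *ᴷ-monoʳ-≤ {x} {y} z 0≤z x≤y = 0≤y-x⇒x≤y (≤-respects ≈-refl
    (≈-trans (R.distribˡ z y (- x)) (R.+-congˡ (≈-sym (-‿distribʳ-* z x)))) (*-nonneg 0≤z (x≤y⇒0≤y-x x≤y)))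

  inverse-nonneg : ∀ {x y} → 0# ≤ᴷ x → (x *ᴷ y) ≈ 1# → 0# ≤ᴷ y
  inverse-nonneg {x} {y} 0≤x xy≈1 with ≤ᴷ.total 0# y
  ... | inj₁ 0≤y = 0≤y
  ... | inj₂ y≤0 = contradiction (≤ᴷ.antisym 0≤1 1≤0) 0≉1
    where
    1≤0 : 1# ≤ᴷ 0#
    1≤0 = ≤-respects xy≈1 (R.zeroʳ x) (*ᴷ-monoʳ-≤ x 0≤x y≤0)

  *-inverse-cancel : ∀ {x y} z → (x *ᴷ y) ≈ 1# → (y *ᴷ (x *ᴷ z)) ≈ z
  *-inverse-cancel {x} {y} z xy≈1 =
    ≈-trans (≈-sym (R.*-assoc y x z)) (≈-trans (R.*-congʳ (≈-trans (R.*-comm y x) xy≈1)) (R.*-identityˡ z))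

  *ᴷ-cancelˡ-≤ : ∀ {x y} z → 0# ≤ᴷ z → ¬ (z ≈ 0#) → (z *ᴷ x) ≤ᴷ (z *ᴷ y) → x ≤ᴷ y
  *ᴷ-cancelˡ-≤ {x} {y} z 0≤z z≉0 zx≤zy with inverse z z≉0
  ... | w , zw≈1 = ≤-respects (*-inverse-cancel x zw≈1) (*-inverse-cancel y zw≈1)
    (*ᴷ-monoʳ-≤ w (inverse-nonneg 0≤z zw≈1) zx≤zy)

  fromℕ-+ : ∀ m n → fromℕ (m + n) ≈ (fromℕ m +ᴷ fromℕ n)
  fromℕ-+ = ×-homo-+ 1#

  fromℕ-* : ∀ m n → fromℕ (m * n) ≈ (fromℕ m *ᴷ fromℕ n)
  fromℕ-* = ×1-homo-*

  0≤fromℕ : ∀ n → 0# ≤ᴷ fromℕ n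
  0≤fromℕ zero    = ≤ᴷ.refl
  0≤fromℕ (suc n) = ≤-respects (R.+-identityˡ 0#) ≈-refl (+ᴷ-mono-≤ 0≤1 (0≤fromℕ n))

  fromℕ-mono : ∀ {m n} → m ≤ n → fromℕ m ≤ᴷ fromℕ n
  fromℕ-mono {n = n} z≤n = 0≤fromℕ n
  fromℕ-mono (s≤s m≤n) = +ᴷ-mono-≤ ≤ᴷ.refl (fromℕ-mono m≤n)

  fromℕ-suc≉0 : ∀ n → ¬ (fromℕ (suc n) ≈ 0#)
  fromℕ-suc≉0 n eq = 0≉1 (≤ᴷ.antisym 0≤1
    (≤-respects (R.+-identityʳ 1#) eq (+ᴷ-mono-≤ ≤ᴷ.refl (0≤fromℕ n))))

  fromℕ≉0 : ∀ {n} → n ≢ 0 → ¬ (fromℕ n ≈ 0#)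
  fromℕ≉0 {zero}  n≢0 = contradiction refl n≢0
  fromℕ≉0 {suc n} _   = fromℕ-suc≉0 n

  module _ {γ : Carrier} {p q : ℕ} (qγ≈p : (fromℕ q *ᴷ γ) ≈ fromℕ p) (q≢0 : q ≢ 0) where

    scale : ∀ b → fromℕ (p * b) ≈ (fromℕ q *ᴷ (γ *ᴷ fromℕ b))
    scale b = ≈-trans (fromℕ-* p b) (≈-trans (R.*-congʳ (≈-sym qγ≈p)) (R.*-assoc _ _ _))

    ratio-≤ : ∀ {a b} → q * a ≤ p * b → fromℕ a ≤ᴷ (γ *ᴷ fromℕ b)
    ratio-≤ {a} {b} qa≤pb = *ᴷ-cancelˡ-≤ (fromℕ q) (0≤fromℕ q) (fromℕ≉0 q≢0)
      (≤-respects (fromℕ-* q a) (scale b) (fromℕ-mono qa≤pb))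

    ratio-≥ : ∀ {a b} → p * b ≤ q * a → (γ *ᴷ fromℕ b) ≤ᴷ fromℕ a
    ratio-≥ {a} {b} pb≤qa = *ᴷ-cancelˡ-≤ (fromℕ q) (0≤fromℕ q) (fromℕ≉0 q≢0)
      (≤-respects (scale b) (fromℕ-* q a) (fromℕ-mono pb≤qa))

  fromℕ-∑-≥ : ∀ {a} (live d : ℕ → ℕ) n → (∀ i → i < n → live i ≢ 0 → a ≤ᴷ fromℕ (d i)) →
    (fromℕ (∑ n (indicator ∘ nonzero ∘ live)) *ᴷ a) ≤ᴷ fromℕ (∑ n (λ i → if nonzero (live i) then d i else 0))
  fromℕ-∑-≥ {a} live d zero    h = ≤ᴷ.reflexive (R.zeroˡ a)
  fromℕ-∑-≥ {a} live d (suc n) h = ≤-respects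
    (≈-sym (≈-trans (R.*-congʳ (fromℕ-+ (∑ n (indicator ∘ nonzero ∘ live)) (indicator (nonzero (live n))))) (R.distribʳ a _ _)))
    (≈-sym (fromℕ-+ (∑ n λ i → if nonzero (live i) then d i else 0) (if nonzero (live n) then d n else 0)))
    (+ᴷ-mono-≤ (fromℕ-∑-≥ live d n λ i i<n → h i (m<n⇒m<1+n i<n)) (last (live n) refl))
    where
    last : ∀ x → live n ≡ x → (fromℕ (indicator (nonzero x)) *ᴷ a) ≤ᴷ fromℕ (if nonzero x then d n else 0)
    last zero    _  = ≤ᴷ.reflexive (R.zeroˡ a)
    last (suc x) eq = ≤-respects (≈-sym (≈-trans (R.*-congʳ (R.+-identityʳ 1#)) (R.*-identityˡ a))) ≈-refl
      (h n ≤-refl λ live≡0 → 0≢1+n (trans (sym live≡0) eq))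

  module _ (γ : Carrier) (2<γ : fromℕ 2 <ᴷ γ) where

    2≤γ : fromℕ 2 ≤ᴷ γ
    2≤γ = proj₁ 2<γ

    0≤γ : 0# ≤ᴷ γ
    0≤γ = ≤ᴷ.trans (0≤fromℕ 2) 2≤γ

    -- With S = ∑ d t over l terminals, S ≤ 2 (opt + l κ) and l γ κ ≤ S give (γ - 2) S ≤ 2 γ opt.
    ratio-bound : ∀ S opt l κ → S ≤ 2 * (opt + l * κ) → (fromℕ l *ᴷ (γ *ᴷ fromℕ κ)) ≤ᴷ fromℕ S →
      fromℕ S ≤ᴷ (2γ/[γ-2] γ 2<γ *ᴷ fromℕ opt)
    ratio-bound S opt l κ S≤ lγκ≤S = ≤-respects (*-inverse-cancel s xw≈1)
      (solve 4 (λ w a g o → w :* ((a :* g) :* o) := ((a :* g) :* w) :* o) ≈-refl w two γ o)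
      (*ᴷ-monoʳ-≤ w (inverse-nonneg (x≤y⇒0≤y-x 2≤γ) xw≈1) scaled)
      where
      s = fromℕ S
      o = fromℕ opt
      two = fromℕ 2
      x = γ +ᴷ (- two)
      w = proj₁ (inverse x (<⇒-≉0 2<γ))
      xw≈1 : (x *ᴷ w) ≈ 1#
      xw≈1 = proj₂ (inverse x (<⇒-≉0 2<γ))
      γs≤ : (γ *ᴷ s) ≤ᴷ (((two *ᴷ γ) *ᴷ o) +ᴷ (two *ᴷ s))
      γs≤ = ≤ᴷ.trans (*ᴷ-monoʳ-≤ γ 0≤γ (≤-respects ≈-refl
          (≈-trans (fromℕ-* 2 (opt + l * κ)) (R.*-congˡ (≈-trans (fromℕ-+ opt (l * κ)) (R.+-congˡ (fromℕ-* l κ))))) (fromℕ-mono S≤)))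
        (≤-respects
          (solve 5 (λ a g o l k → ((a :* g) :* o) :+ (a :* (l :* (g :* k))) := g :* (a :* (o :+ (l :* k)))) ≈-refl two γ o (fromℕ l) (fromℕ κ))
          ≈-refl
          (+ᴷ-mono-≤ ≤ᴷ.refl (*ᴷ-monoʳ-≤ two (0≤fromℕ 2) lγκ≤S)))
      scaled : (x *ᴷ s) ≤ᴷ ((two *ᴷ γ) *ᴷ o)
      scaled = ≤-respects (≈-sym (R.distribʳ s γ (- two)))
        (≈-trans (R.+-assoc _ _ _) (≈-trans (R.+-congˡ
          (≈-trans (≈-sym (R.distribʳ s two (- two))) (≈-trans (R.*-congʳ (R.-‿inverseʳ two)) (R.zeroˡ s)))) (R.+-identityʳ _)))
        (+ᴷ-monoˡ-≤ ((- two) *ᴷ s) γs≤)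

-- The approximation guarantee

module Guarantee {c ℓ₁ ℓ₂} (K : OrderedField c ℓ₁ ℓ₂) (γ : OrderedField.Carrier K)
  (2<γ : OrderedField._<ᴷ_ K (OrderedField.fromℕ K 2) γ) (I : Instance) where

  open OrderedField K using (fromℕ; _≤ᴷ_; _*ᴷ_; *-nonneg; 2γ/[γ-2])
  open FieldProperties K
  open Instance I
  open GraphArrays graph

  terminal : ℕ → ℕ
  terminal = input I 5

  Small Large : ℕ → Set ℓ₂
  Small a = fromℕ a ≤ᴷ (γ *ᴷ fromℕ (k ∸ 1))
  Large a = (γ *ᴷ fromℕ (k ∸ 1)) ≤ᴷ fromℕ a

  ∈⇒terminal : ∀ {v} → v ∈ terminals → terminal (toℕ v) ≢ 0
  ∈⇒terminal {v} v∈T eq = 1+n≢0 (trans (sym (trans (toArray-toℕ _ v) (cong (if_then 1 else 0) ([]=⇒lookup v∈T)))) eq)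

  terminal⇒∈ : ∀ {v} → terminal (toℕ v) ≢ 0 → v ∈ terminals
  terminal⇒∈ {v} v≢0 with lookup terminals v in eq
  ... | true  = lookup⇒[]= v terminals eq
  ... | false = contradiction (trans (toArray-toℕ _ v) (cong (if_then 1 else 0) eq)) v≢0

  -- `output` tests its entries with a function local to it. Once the entry is split into zero and
  -- successor, that test and `nonzero` both compute to the same value.
  lookup-output : ∀ σ e → lookup (output I σ) e ≡ nonzero (σ 6 (toℕ e))
  lookup-output σ e with σ 6 (toℕ e) | trans {j = lookup (output I σ) e} refl (lookup∘tabulate _ e)
  ... | zero  | eq = eq
  ... | suc _ | eq = eq

  member-output : ∀ σ e → e < #E → member (output I σ) e ≡ nonzero (σ 6 e)
  member-output σ = onFin _ λ e → trans (member-lookup (output I σ) e) (lookup-output σ e)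

  ∣output∣≤∑ : ∀ σ → ∣ output I σ ∣ ≤ ∑ #E (σ 6)
  ∣output∣≤∑ σ = ≤-trans (≤-reflexive (∣∣-∑ (output I σ)))
    (∑-mono #E λ e e<m → ≤-trans (≤-reflexive (cong indicator (member-output σ e e<m))) (below (σ 6 e)))
    where
    below : ∀ x → indicator (nonzero x) ≤ x
    below zero    = z≤n
    below (suc x) = s≤s z≤n

  open Network #V #E tails heads
  open Rounds #V #E tails heads terminal Small Large

  module _ (σ : ℕ → ℕ → ℕ) (progress : Progress (σ 5) (σ 6) #V) where

    open Progress progress
    F = output I σ
    live = σ 5
    module MengerF = Menger graph F

    -- The small cut lives in the original graph; after the deletion of `F` it can only have fewer
    -- edges, and these bound the number of disjoint paths.
    apart⇒small : ∀ {s t} → Apart (toℕ s) (toℕ t) → ∀ j → HasEdgeDisjointPaths graph F s t j → Small j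
    apart⇒small (X , X≢ , small) j paths = ≤ᴷ.trans
      (fromℕ-mono (≤-trans (MengerF.paths≤cut X j paths X≢)
        (∑-mono #E λ e _ → indicator-∧ (crosses X e) (not (member F e))))) small
      where
      indicator-∧ : ∀ x y → indicator (x ∧ y) ≤ indicator x
      indicator-∧ true  y = indicator≤1 y
      indicator-∧ false y = z≤n

    cut⇒disconnected : ∀ {s t R} → R (toℕ s) ≢ R (toℕ t) → (∀ e → e < #E → crosses R e ≡ true → σ 6 e ≢ 0) →
      ∀ j → HasEdgeDisjointPaths graph F s t j → j ≤ 0
    cut⇒disconnected {R = R} R≢ deleted j paths =
      ≤-trans (MengerF.paths≤cut R j paths R≢) (≤-reflexive (∑-zero #E none))
      where
      none : ∀ e → e < #E → indicator (MengerF.surviving R e) ≡ 0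
      none e e<m with crosses R e in cr
      ... | false = refl
      ... | true  = cong (indicator ∘ not) (trans (member-output σ e e<m) (nonzero-true (deleted e e<m cr)))

    connectivity : ∀ s t → s ∈ terminals → t ∈ terminals → s ≢ t →
      ∀ j → HasEdgeDisjointPaths graph F s t j → Small j
    connectivity s t s∈T t∈T s≢t j paths with live (toℕ s) ≟ 0 | live (toℕ t) ≟ 0
    ... | yes dead | _ = apart⇒small
      (apart _ _ (toℕ<n s) (toℕ<n t) (∈⇒terminal s∈T) (∈⇒terminal t∈T) (s≢t ∘ toℕ-injective) (inj₁ dead)) j paths
    ... | no _ | yes dead = apart⇒small
      (apart _ _ (toℕ<n s) (toℕ<n t) (∈⇒terminal s∈T) (∈⇒terminal t∈T) (s≢t ∘ toℕ-injective) (inj₂ dead)) j paths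
    ... | no live-s | no live-t with Isolated.cut (isolated (toℕ s) (toℕ<n s) live-s)
    ...   | R , iso , deleted = ≤ᴷ.trans
      (fromℕ-mono {n = 0} (cut⇒disconnected {s} {t} {R} R≢ deleted j paths))
      (*-nonneg (0≤γ γ 2<γ) (0≤fromℕ (k ∸ 1)))
      where
      open Isolates iso
      R≢ : R (toℕ s) ≢ R (toℕ t)
      R≢ eq = true≢false (trans (sym inside)
        (trans eq (outside (toℕ t) (toℕ<n t) live-t (s≢t ∘ toℕ-injective ∘ sym))))

    module _ (F* : Subset #E) (feasible : Feasible I F*) where

      kept : ℕ → Bool
      kept e = not (member F* e)

      Separable : ℕ → ℕ → Set
      Separable s t = live s ≢ 0 → live t ≢ 0 → s ≢ t →
        Σ[ X ∈ (ℕ → Bool) ] X s ≢ X t × ∑ #E (λ e → indicator ((X (tails e) xor X (heads e)) ∧ kept e)) ≤ k ∸ 1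

      separable : ∀ s t → s < #V → t < #V → Separable s t
      separable s t s<n t<n = onFin (λ s → Separable s t) (λ s → onFin (Separable (toℕ s)) (at s) t t<n) s s<n
        where
        at : ∀ s t → Separable (toℕ s) (toℕ t)
        at s t live-s live-t s≢t with Menger.menger graph F* s t k
        ... | inj₁ paths = contradiction
          (feasible s t (terminal⇒∈ (subset _ (toℕ<n s) live-s)) (terminal⇒∈ (subset _ (toℕ<n t) live-t)) (s≢t ∘ cong toℕ) k paths)
          -- As `k` is at least 1, `k ∸ 1` is its true predecessor, and `k` disjoint paths exceed
          -- what feasibility allows.
          (<⇒≱ (≤-reflexive (m+[n∸m]≡n k≥1)))
        ... | inj₂ (X , X≢ , X<k) = X , X≢ , ∸-monoˡ-≤ 1 X<k

      cost-bound : fromℕ ∣ F ∣ ≤ᴷ (2γ/[γ-2] γ 2<γ *ᴷ fromℕ ∣ F* ∣)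
      cost-bound = ≤ᴷ.trans (fromℕ-mono (≤-trans (∣output∣≤∑ σ) (≤-reflexive total)))
        (ratio-bound γ 2<γ _ ∣ F* ∣ (liveBelow #V) (k ∸ 1)
          (≤-trans (isolating-total d λ t t<n live-t → Isolated.minimal (isolated t t<n live-t))
            (≤-reflexive (cong (λ x → 2 * (x + liveBelow #V * (k ∸ 1))) deleted≡)))
          (fromℕ-∑-≥ live d #V λ t t<n live-t → Isolated.large (isolated t t<n live-t)))
        where
        open Partition #V #E tails heads live kept (k ∸ 1) separable
        deleted≡ : ∑ #E (indicator ∘ not ∘ kept) ≡ ∣ F* ∣
        deleted≡ = trans (∑-cong #E λ e _ → cong indicator (Boolₚ.not-involutive (member F* e))) (sym (∣∣-∑ F*))

    isApproximation : IsApproximation I K γ (2γ/[γ-2] γ 2<γ) F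
    isApproximation = record
      { cost = λ { _ ((F* , feasible , refl) , _) → cost-bound F* feasible }
      ; connectivity = connectivity
      }

-- Comparison of a cut value with γ (k ∸ 1)

module Threshold {c ℓ₁ ℓ₂} (K : OrderedField c ℓ₁ ℓ₂) (γ : OrderedField.Carrier K) where

  open OrderedField K using (fromℕ; _≤ᴷ_; _≤ᴷ?_; _≈_; _*ᴷ_)
  open FieldProperties K
  open RAM using (Expr; const; _[_]; _⊕_; _⊖_; ask)

  -- Multiplication by a fixed number, unrolled into additions because the machine cannot multiply;
  -- its cost depends on γ but not on the instance.
  times : ∀ {Q test} → ℕ → Expr Q test → Expr Q test
  times zero    e = const 0
  times (suc n) e = e ⊕ times n e

  eval-times : ∀ {Q test} n (e : Expr Q test) σ → RAM.eval Q test (times n e) σ ≡ n * RAM.eval Q test e σ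
  eval-times zero    e σ = refl
  eval-times (suc n) e σ = cong (_ +_) (eval-times n e σ)

  -- For γ = p/q the added 1 makes the truncated difference nonzero exactly if `q` times the cut
  -- value is at most `p * (k ∸ 1)`, equality included.
  small : (pr : Presentation K γ) → Expr (Test pr) (runTest pr)
  small (ratio p q _ _) = (const 1 ⊕ times p (2 [ const 0 ] ⊖ const 1)) ⊖ times q (12 [ const 0 ])
  small real            = ask tt (12 [ const 0 ]) (2 [ const 0 ] ⊖ const 1)

  does-true : ∀ {p} {P : Set p} (P? : Dec P) → (if does P? then 1 else 0) ≢ 0 → P
  does-true (yes p) _  = p
  does-true (no _)  ≢0 = contradiction refl ≢0

  does-false : ∀ {p} {P : Set p} (P? : Dec P) → (if does P? then 1 else 0) ≡ 0 → ¬ P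
  does-false (no ¬p) _ = ¬p

  eval-small : ∀ p q q≢0 qγ≈p σ → RAM.eval _ _ (small (ratio p q q≢0 qγ≈p)) σ ≡ suc (p * (σ 2 0 ∸ 1)) ∸ q * σ 12 0
  eval-small p q _ _ σ = cong₂ (λ x y → suc x ∸ y) (eval-times p (2 [ const 0 ] ⊖ const 1) σ) (eval-times q (12 [ const 0 ]) σ)

  eval-small≢0 : ∀ pr σ → RAM.eval _ _ (small pr) σ ≢ 0 → fromℕ (σ 12 0) ≤ᴷ (γ *ᴷ fromℕ (σ 2 0 ∸ 1))
  eval-small≢0 (ratio p q q≢0 qγ≈p) σ ≢0 = ratio-≤ {p = p} {q} qγ≈p q≢0 {b = σ 2 0 ∸ 1}
    (≤-pred (m∸n≢0⇒n<m (λ eq → ≢0 (trans (eval-small p q q≢0 qγ≈p σ) eq))))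
  eval-small≢0 real σ ≢0 = does-true (fromℕ (σ 12 0) ≤ᴷ? (γ *ᴷ fromℕ (σ 2 0 ∸ 1))) ≢0

  eval-small≡0 : ∀ pr σ → RAM.eval _ _ (small pr) σ ≡ 0 → (γ *ᴷ fromℕ (σ 2 0 ∸ 1)) ≤ᴷ fromℕ (σ 12 0)
  eval-small≡0 (ratio p q q≢0 qγ≈p) σ ≡0 = ratio-≥ {p = p} {q} qγ≈p q≢0 {b = σ 2 0 ∸ 1}
    (<⇒≤ (m∸n≡0⇒m≤n (trans (sym (eval-small p q q≢0 qγ≈p σ)) ≡0)))
  eval-small≡0 real σ ≡0 with ≤ᴷ.total (fromℕ (σ 12 0)) (γ *ᴷ fromℕ (σ 2 0 ∸ 1))
  ... | inj₁ below = contradiction below (does-false (fromℕ (σ 12 0) ≤ᴷ? (γ *ᴷ fromℕ (σ 2 0 ∸ 1))) ≡0)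
  ... | inj₂ above = above

-- The algorithm run on an instance

module Main {c ℓ₁ ℓ₂} (K : OrderedField c ℓ₁ ℓ₂) (γ : OrderedField.Carrier K)
  (2<γ : OrderedField._<ᴷ_ K (OrderedField.fromℕ K 2) γ) (pr : Presentation K γ) where

  open OrderedField K using (fromℕ; _≤ᴷ_; _*ᴷ_; 2γ/[γ-2])
  open Threshold K γ
  open Algorithm (Test pr) (runTest pr) (small pr)
  open RAM (Test pr) (runTest pr) using (⟨_,_⟩⇓_in-time_)

  run : ∀ I → ∃[ σ ] ∃[ t ] ⟨ algorithm , input I ⟩⇓ σ in-time t
    × t ≤ algorithmTime (Instance.#V I) (Instance.#E I)
    × IsApproximation I K γ (2γ/[γ-2] γ 2<γ) (output I σ)
  run I = finish (algorithm-run #V #E k tails heads tails<#V heads<#V terminal Small Large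
      (λ σ inp ≢0 → subst (λ k → fromℕ (σ 12 0) ≤ᴷ (γ *ᴷ fromℕ (k ∸ 1))) (InputAre.k≡ inp) (eval-small≢0 pr σ ≢0))
      (λ σ inp ≡0 → subst (λ k → (γ *ᴷ fromℕ (k ∸ 1)) ≤ᴷ fromℕ (σ 12 0)) (InputAre.k≡ inp) (eval-small≡0 pr σ ≡0))
      {input I} (record { n≡ = refl ; m≡ = refl ; k≡ = refl ; A≡ = refl ; B≡ = refl })
      (Rounds.progress-start #V #E tails heads terminal Small Large (λ _ _ → refl) (λ _ _ → refl)))
    where
    open Instance I
    open GraphArrays graph
    open Guarantee K γ 2<γ I
    finish : _ → _
    finish (σ , t , halts , t≤ , progress) = σ , t , halts , t≤ , isApproximation σ progress

  within-polynomial : Polynomial algorithmTime → HasPolynomialTimeApproximation K pr γ (2γ/[γ-2] γ 2<γ)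
  within-polynomial (C , d , bound) = algorithm , C , d , λ I → polynomial I (run I)
    where
    polynomial : ∀ I → _ → ∃[ σ ] ∃[ t ] ⟨ algorithm , input I ⟩⇓ σ in-time t
      × t ≤ C * size I ^ d × IsApproximation I K γ (2γ/[γ-2] γ 2<γ) (output I σ)
    polynomial I (σ , t , halts , t≤ , approximates) = σ , t , halts
      -- The size dominates both parameters, and it is at least 1 even for the empty graph, thanks
      -- to the `suc` before the logarithm.
      , ≤-trans t≤ (bound #V #E (size I)
          (m≤n⇒m≤o+n (#V + #E) (s≤s z≤n)) (m≤n⇒m≤n+o _ (m≤m+n #V #E)) (m≤n⇒m≤n+o _ (m≤n+m #E #V)))
      , approximates
      where open Instance I

theorem2p2 : ∀ {c ℓ₁ ℓ₂} (K : OrderedField c ℓ₁ ℓ₂) → let open OrderedField K in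
    (γ : Carrier) (2<γ : fromℕ 2 <ᴷ γ) (pr : Presentation K γ) →
    HasPolynomialTimeApproximation K pr γ (2γ/[γ-2] γ 2<γ)
theorem2p2 K γ 2<γ pr = Main.within-polynomial K γ 2<γ pr algorithmTime-polynomial
  where open Algorithm (Test pr) (runTest pr) (Threshold.small K γ pr)
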